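{- Let $b>3$ be an integer. Then, as $x\to\infty$, \[\sum_{n\leq x}\left(1-\frac{n}{x}\right)h_b(n)= \frac{\zeta(2b-1)}{6\zeta(2b)}x^2 +O_b(x\log x).\]
   Context: For an integer $b\ge 2$ and positive integers $m,n$, the generalized gcd is $(m,n)_b:=\max\{d\ge 1: d^b\mid m \text{ and } d^b\mid n\}$. The generalized gcd-sum function is $h_b(n):=\sum_{1\le j\le n}(j,n)_b$. Here $\zeta$ is the Riemann zeta function, $x$ is a real variable, sums over $n\le x$ run over positive integers $n$, and $O_b$ means that the implied constant may depend on $b$. -}

module Defs where

open import Data.Nat as ℕ using (ℕ; zero; suc)
import Data.Nat.Properties as ℕₚ
open import Data.Nat.Divisibility using (_∣?_)
open import Data.Integer using (+_)
import Data.Integer as ℤ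
import Data.Integer.Properties as ℤₚ
open import Data.Rational as Rat using (ℚ; 0ℚ; 1ℚ; mkℚ)
import Data.Rational.Properties as ℚₚ
open import Data.Rational.Solver using (module +-*-Solver)
import Data.Rational.Unnormalised as ℚᵘ
import Data.Rational.Unnormalised.Properties as ℚᵘₚ
open import Data.List using (List; map; filter; upTo)
open import Data.Nat.ListAction using (sum)
open import Data.List.Extrema.Nat using (max)
open import Data.Product using (∃; ∃-syntax; _×_; _,_; proj₁; proj₂)
open import Data.Sum using (inj₁; inj₂)
open import Relation.Nullary using (yes; no; contradiction; _×-dec_)
open import Relation.Binary.PropositionalEquality
  using (_≡_; refl; sym; trans; cong; cong₂; subst; subst₂)

------------------------------------------------------------------------

[1⋯_] : ℕ → List ℕ
[1⋯ n ] = map suc (upTo n)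

-- (m , n)_b for b ≥ 1 and m ≥ 1. The search can stop at m: if d ≥ 1 and
-- d ^ b ∣ m, then d ≤ d ^ b ≤ m. The candidate d = 1 is always admissible.
gcd[_] : ℕ → ℕ → ℕ → ℕ
gcd[ b ] m n =
  max 1 (filter (λ d → (d ℕ.^ b ∣? m) ×-dec (d ℕ.^ b ∣? n)) [1⋯ m ])

h : ℕ → ℕ → ℕ
h b n = sum (map (λ j → gcd[ b ] j n) [1⋯ n ])

------------------------------------------------------------------------

ℕ→ℚ : ℕ → ℚ
ℕ→ℚ n = + n Rat./ 1

-- Total reciprocal; only its values at nonzero arguments ever matter.
recip : ℚ → ℚ
recip p with p Rat.≟ 0ℚ
... | yes _   = 0ℚ
... | no  p≢0 = (Rat.1/ p) {{Rat.≢-nonZero p≢0}}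

∑ℚ : ℕ → (ℕ → ℚ) → ℚ
∑ℚ zero    f = 0ℚ
∑ℚ (suc n) f = ∑ℚ n f Rat.+ f n

IsCauchy : (ℕ → ℚ) → Set
IsCauchy x = ∀ ε → 0ℚ Rat.< ε →
  ∃[ N ] (∀ m n → N ℕ.≤ m → N ℕ.≤ n → Rat.∣ x m Rat.- x n ∣ Rat.≤ ε)

-- The right-endpoint Riemann sum of ∫₁ˣ dt/t over 2 ^ k equal steps.
riemann : ℕ → ℚ → ℚ
riemann k x = ∑ℚ (2 ℕ.^ k) (λ i → w Rat.* recip (1ℚ Rat.+ ℕ→ℚ (suc i) Rat.* w))
  where
  w : ℚ
  w = (x Rat.- 1ℚ) Rat.* recip (ℕ→ℚ (2 ℕ.^ k))

ζ-partial : ℕ → ℕ → ℚ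
ζ-partial s n = ∑ℚ n (λ i → recip (ℕ→ℚ (suc i ℕ.^ s)))

module RationalLemmas where
  open Rat using (_+_; _*_; _-_; -_; ∣_∣; _≤_; _<_)
  open ℚₚ using (≤-refl; ≤-trans; ≤-reflexive; <⇒≤; <-≤-trans; +-mono-≤)
  open +-*-Solver using (solve; _:+_; _:*_; _:-_; :-_; _:=_; con)

  0≤⇒≤ : ∀ {p q} → 0ℚ ≤ q - p → p ≤ q
  0≤⇒≤ {p} {q} h = subst₂ _≤_ (ℚₚ.+-identityˡ p)
    (solve 2 (λ p q → (q :- p) :+ p := q) refl p q) (ℚₚ.+-monoˡ-≤ p h)

  ≤⇒0≤ : ∀ {p q} → p ≤ q → 0ℚ ≤ q - p
  ≤⇒0≤ {p} {q} h = subst (_≤ q - p) (ℚₚ.+-inverseʳ p) (ℚₚ.+-monoˡ-≤ (- p) h)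

  0≤+ : ∀ {p q} → 0ℚ ≤ p → 0ℚ ≤ q → 0ℚ ≤ p + q
  0≤+ = +-mono-≤

  0<+ : ∀ {p q} → 0ℚ < p → 0ℚ ≤ q → 0ℚ < p + q
  0<+ = ℚₚ.+-mono-<-≤

  *-mono-≤ : ∀ {a b c d} → 0ℚ ≤ a → 0ℚ ≤ c → a ≤ b → c ≤ d → a * c ≤ b * d
  *-mono-≤ {a} {b} {c} {d} 0≤a 0≤c a≤b c≤d = ≤-trans
    (ℚₚ.*-monoʳ-≤-nonNeg c {{Rat.nonNegative 0≤c}} a≤b)
    (ℚₚ.*-monoˡ-≤-nonNeg b {{Rat.nonNegative (≤-trans 0≤a a≤b)}} c≤d)

  *-monoˡ : ∀ {a c d} → 0ℚ ≤ a → c ≤ d → a * c ≤ a * d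
  *-monoˡ {a} 0≤a c≤d = ℚₚ.*-monoˡ-≤-nonNeg a {{Rat.nonNegative 0≤a}} c≤d

  0≤* : ∀ {p q} → 0ℚ ≤ p → 0ℚ ≤ q → 0ℚ ≤ p * q
  0≤* {p} {q} 0≤p 0≤q = subst (_≤ p * q) (ℚₚ.*-zeroʳ p) (*-monoˡ 0≤p 0≤q)

  0<* : ∀ {p q} → 0ℚ < p → 0ℚ < q → 0ℚ < p * q
  0<* {p} {q} 0<p 0<q = ℚₚ.positive⁻¹ (p * q)
    {{ℚₚ.pos*pos⇒pos p {{Rat.positive 0<p}} q {{Rat.positive 0<q}}}}

  0<1 : 0ℚ < 1ℚ
  0<1 = ℚₚ.positive⁻¹ 1ℚ

  0≤∣∣ : ∀ p → 0ℚ ≤ ∣ p ∣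
  0≤∣∣ = ℚₚ.0≤∣p∣

  ∣∣-comm : ∀ p q → ∣ p - q ∣ ≡ ∣ q - p ∣
  ∣∣-comm p q = trans (sym (ℚₚ.∣-p∣≡∣p∣ (p - q)))
    (cong ∣_∣ (solve 2 (λ p q → :- (p :- q) := q :- p) refl p q))

  ∣∣-triangle : ∀ p q r → ∣ p - r ∣ ≤ ∣ p - q ∣ + ∣ q - r ∣
  ∣∣-triangle p q r = subst (λ t → ∣ t ∣ ≤ ∣ p - q ∣ + ∣ q - r ∣)
    (solve 3 (λ p q r → (p :- q) :+ (q :- r) := p :- r) refl p q r)
    (ℚₚ.∣p+q∣≤∣p∣+∣q∣ (p - q) (q - r))

  p≤∣p∣ : ∀ p → p ≤ ∣ p ∣
  p≤∣p∣ p with ℚₚ.≤-total 0ℚ p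
  ... | inj₁ 0≤p = ≤-reflexive (sym (ℚₚ.0≤p⇒∣p∣≡p 0≤p))
  ... | inj₂ p≤0 = ≤-trans p≤0 (0≤∣∣ p)

  ∣∣≤ : ∀ {p q} → p ≤ q → - p ≤ q → ∣ p ∣ ≤ q
  ∣∣≤ {p} {q} p≤q -p≤q with ℚₚ.∣p∣≡p∨∣p∣≡-p p
  ... | inj₁ e = subst (_≤ q) (sym e) p≤q
  ... | inj₂ e = subst (_≤ q) (sym e) -p≤q

  ∣∣-reverse : ∀ p q → ∣ ∣ p ∣ - ∣ q ∣ ∣ ≤ ∣ p - q ∣
  ∣∣-reverse p q = ∣∣≤ (half p q)
    (subst (_≤ ∣ p - q ∣)
      (solve 2 (λ a b → b :- a := :- (a :- b)) refl ∣ p ∣ ∣ q ∣)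
      (subst (∣ q ∣ - ∣ p ∣ ≤_) (∣∣-comm q p) (half q p)))
    where
    half : ∀ p q → ∣ p ∣ - ∣ q ∣ ≤ ∣ p - q ∣
    half p q = subst (∣ p ∣ - ∣ q ∣ ≤_)
      (solve 2 (λ d b → (d :+ b) :- b := d) refl ∣ p - q ∣ ∣ q ∣)
      (ℚₚ.+-monoˡ-≤ (- ∣ q ∣)
        (subst (λ t → ∣ t ∣ ≤ ∣ p - q ∣ + ∣ q ∣)
          (solve 2 (λ p q → (p :- q) :+ q := p) refl p q)
          (ℚₚ.∣p+q∣≤∣p∣+∣q∣ (p - q) q)))

  ∣-∣≤-between : ∀ {p q e} → 0ℚ ≤ p → p ≤ e → 0ℚ ≤ q → q ≤ e → ∣ p - q ∣ ≤ e
  ∣-∣≤-between {p} {q} {e} 0≤p p≤e 0≤q q≤e = ∣∣≤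
    (0≤⇒≤ (subst (0ℚ ≤_)
      (solve 3 (λ p q e → (e :- p) :+ q := e :- (p :- q)) refl p q e)
      (0≤+ (≤⇒0≤ p≤e) 0≤q)))
    (0≤⇒≤ (subst (0ℚ ≤_)
      (solve 3 (λ p q e → (e :- q) :+ p := e :- (:- (p :- q))) refl p q e)
      (0≤+ (≤⇒0≤ q≤e) 0≤p)))

  ----------------------------------------------------------------------

  private
    ℕ→ℚᵘ : ∀ n → Rat.toℚᵘ (ℕ→ℚ n) ℚᵘ.≃ ℚᵘ.mkℚᵘ (+ n) 0
    ℕ→ℚᵘ n = ℚₚ.toℚᵘ-fromℚᵘ (ℚᵘ.mkℚᵘ (+ n) 0)

  ℕ→ℚ-+ : ∀ m n → ℕ→ℚ (m ℕ.+ n) ≡ ℕ→ℚ m + ℕ→ℚ n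
  ℕ→ℚ-+ m n = ℚₚ.toℚᵘ-injective
    (ℚᵘₚ.≃-trans (ℕ→ℚᵘ (m ℕ.+ n))
    (ℚᵘₚ.≃-trans (ℚᵘ.*≡* (cong (ℤ._* + 1) (trans (ℤₚ.pos-+ m n)
        (sym (cong₂ ℤ._+_ (ℤₚ.*-identityʳ (+ m)) (ℤₚ.*-identityʳ (+ n)))))))
    (ℚᵘₚ.≃-sym (ℚᵘₚ.≃-trans (ℚₚ.toℚᵘ-homo-+ (ℕ→ℚ m) (ℕ→ℚ n))
      (ℚᵘₚ.+-cong (ℕ→ℚᵘ m) (ℕ→ℚᵘ n))))))

  ℕ→ℚ-* : ∀ m n → ℕ→ℚ (m ℕ.* n) ≡ ℕ→ℚ m * ℕ→ℚ n
  ℕ→ℚ-* zero    n = sym (ℚₚ.*-zeroˡ (ℕ→ℚ n))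
  ℕ→ℚ-* (suc m) n = trans (ℕ→ℚ-+ n (m ℕ.* n))
    (trans (cong (λ t → ℕ→ℚ n + t) (ℕ→ℚ-* m n))
    (trans (solve 2 (λ m n → n :+ m :* n := (con 1ℚ :+ m) :* n) refl (ℕ→ℚ m) (ℕ→ℚ n))
      (cong (_* ℕ→ℚ n) (sym (ℕ→ℚ-+ 1 m)))))

  0≤ℕ→ℚ : ∀ n → 0ℚ ≤ ℕ→ℚ n
  0≤ℕ→ℚ zero    = ≤-refl
  0≤ℕ→ℚ (suc n) = subst (0ℚ ≤_) (sym (ℕ→ℚ-+ 1 n)) (0≤+ (<⇒≤ 0<1) (0≤ℕ→ℚ n))

  ℕ→ℚ-mono : ∀ {m n} → m ℕ.≤ n → ℕ→ℚ m ≤ ℕ→ℚ n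
  ℕ→ℚ-mono {n = n}     ℕ.z≤n       = 0≤ℕ→ℚ n
  ℕ→ℚ-mono {suc m} {suc n} (ℕ.s≤s m≤n) rewrite ℕ→ℚ-+ 1 m | ℕ→ℚ-+ 1 n =
    ℚₚ.+-monoʳ-≤ 1ℚ (ℕ→ℚ-mono m≤n)

  0<ℕ→ℚ : ∀ {n} → 1 ℕ.≤ n → 0ℚ < ℕ→ℚ n
  0<ℕ→ℚ 1≤n = <-≤-trans 0<1 (ℕ→ℚ-mono 1≤n)

  recip-inverse : ∀ {p} → 0ℚ < p → p * recip p ≡ 1ℚ
  recip-inverse {p} 0<p with p Rat.≟ 0ℚ
  ... | yes p≡0 = contradiction (sym p≡0) (ℚₚ.<⇒≢ 0<p)
  ... | no  p≢0 = ℚₚ.*-inverseʳ p {{Rat.≢-nonZero p≢0}}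

  0<recip : ∀ {p} → 0ℚ < p → 0ℚ < recip p
  0<recip {p} 0<p with p Rat.≟ 0ℚ
  ... | yes p≡0 = contradiction (sym p≡0) (ℚₚ.<⇒≢ 0<p)
  ... | no  p≢0 = ℚₚ.positive⁻¹ _ {{ℚₚ.1/pos⇒pos p {{Rat.positive 0<p}}}}

  recip-difference : ∀ {p q} → 0ℚ < p → 0ℚ < q →
                     recip p - recip q ≡ (recip p * recip q) * (q - p)
  recip-difference {p} {q} 0<p 0<q = trans
    (solve 2 (λ a b → a :- b := a :* con 1ℚ :- b :* con 1ℚ) refl (recip p) (recip q))
    (trans (cong₂ (λ s t → recip p * s - recip q * t)
             (sym (recip-inverse 0<q)) (sym (recip-inverse 0<p)))
      (solve 4 (λ p q a b → a :* (q :* b) :- b :* (p :* a) := (a :* b) :* (q :- p))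
        refl p q (recip p) (recip q)))

  recip-anti : ∀ {p q} → 0ℚ < p → p ≤ q → recip q ≤ recip p
  recip-anti {p} {q} 0<p p≤q = 0≤⇒≤
    (subst (0ℚ ≤_) (sym (recip-difference 0<p 0<q))
      (0≤* (0≤* (<⇒≤ (0<recip 0<p)) (<⇒≤ (0<recip 0<q))) (≤⇒0≤ p≤q)))
    where
    0<q = <-≤-trans 0<p p≤q

  archimedean : ∀ ε → 0ℚ < ε → ∃[ N ] (1 ℕ.≤ N × recip (ℕ→ℚ N) ≤ ε)
  archimedean ε 0<ε = N , ℕ.s≤s ℕ.z≤n , subst₂ _≤_ (ℚₚ.*-identityʳ _) e
      (*-monoˡ (<⇒≤ (0<recip 0<N)) (1≤ ε 0<ε))
    where
    N = Rat.↧ₙ ε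
    0<N = 0<ℕ→ℚ {N} (ℕ.s≤s ℕ.z≤n)
    e : recip (ℕ→ℚ N) * (ℕ→ℚ N * ε) ≡ ε
    e = trans (solve 3 (λ r n e → r :* (n :* e) := (n :* r) :* e) refl (recip (ℕ→ℚ N)) (ℕ→ℚ N) ε)
      (trans (cong (_* ε) (recip-inverse 0<N)) (ℚₚ.*-identityˡ ε))
    1≤ : ∀ ε → 0ℚ < ε → 1ℚ ≤ ℕ→ℚ (Rat.↧ₙ ε) * ε
    1≤ ε@(mkℚ ℤ.-[1+ a ] d _) 0<ε with Rat.positive 0<ε
    ... | ()
    1≤ ε@(mkℚ (+ zero) d _) 0<ε with Rat.positive 0<ε
    ... | ()
    1≤ ε@(mkℚ (+ suc a) d _) 0<ε = ℚₚ.toℚᵘ-cancel-≤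
      (ℚᵘₚ.≤-respʳ-≃ (ℚᵘₚ.≃-sym (ℚᵘₚ.≃-trans (ℚₚ.toℚᵘ-homo-* (ℕ→ℚ (suc d)) ε)
          (ℚᵘₚ.*-congʳ {Rat.toℚᵘ ε} (ℕ→ℚᵘ (suc d)))))
        (ℚᵘ.*≤* (ℤ.+≤+ (le a d))))
      where
      le : ∀ a d → 1 ℕ.* suc (d ℕ.+ 0) ℕ.≤ suc d ℕ.* suc a ℕ.* 1
      le a d = ℕₚ.≤-trans
        (ℕₚ.≤-reflexive (trans (ℕₚ.*-identityˡ _) (cong suc (ℕₚ.+-identityʳ d))))
        (ℕₚ.≤-trans (ℕₚ.m≤m*n (suc d) (suc a)) (ℕₚ.≤-reflexive (sym (ℕₚ.*-identityʳ _))))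

  ----------------------------------------------------------------------

  cauchy-lipschitz : ∀ x y z K → 0ℚ < K → ∀ N → IsCauchy x → IsCauchy y →
    (∀ m n → N ℕ.≤ m → N ℕ.≤ n →
      ∣ z m - z n ∣ ≤ K * (∣ x m - x n ∣ + ∣ y m - y n ∣)) →
    IsCauchy z
  cauchy-lipschitz x y z K 0<K N cx cy lip ε 0<ε =
    let N₁ , p₁ = cx ε′ 0<ε′
        N₂ , p₂ = cy ε′ 0<ε′
        l : ∀ {k} → N ℕ.⊔ (N₁ ℕ.⊔ N₂) ℕ.≤ k → N₁ ℕ.⊔ N₂ ℕ.≤ k
        l q = ℕₚ.≤-trans (ℕₚ.m≤n⊔m N (N₁ ℕ.⊔ N₂)) q
        l₀ : ∀ {k} → N ℕ.⊔ (N₁ ℕ.⊔ N₂) ℕ.≤ k → N ℕ.≤ k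
        l₀ q = ℕₚ.≤-trans (ℕₚ.m≤m⊔n N (N₁ ℕ.⊔ N₂)) q
        l₁ : ∀ {k} → N ℕ.⊔ (N₁ ℕ.⊔ N₂) ℕ.≤ k → N₁ ℕ.≤ k
        l₁ q = ℕₚ.≤-trans (ℕₚ.m≤m⊔n N₁ N₂) (l q)
        l₂ : ∀ {k} → N ℕ.⊔ (N₁ ℕ.⊔ N₂) ℕ.≤ k → N₂ ℕ.≤ k
        l₂ q = ℕₚ.≤-trans (ℕₚ.m≤n⊔m N₁ N₂) (l q)
    in N ℕ.⊔ (N₁ ℕ.⊔ N₂) , λ m n hm hn →
      ≤-trans (lip m n (l₀ hm) (l₀ hn))
      (≤-trans (*-monoˡ (<⇒≤ 0<K) (+-mono-≤ (p₁ m n (l₁ hm) (l₁ hn)) (p₂ m n (l₂ hm) (l₂ hn))))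
        (≤-reflexive e))
    where
    0<2K = 0<+ 0<K (<⇒≤ 0<K)
    ε′ = recip (K + K) * ε
    0<ε′ = 0<* (0<recip 0<2K) 0<ε
    e : K * (ε′ + ε′) ≡ ε
    e = trans (solve 3 (λ k r e → k :* (r :* e :+ r :* e) := ((k :+ k) :* r) :* e) refl K (recip (K + K)) ε)
      (trans (cong (_* ε) (recip-inverse 0<2K)) (ℚₚ.*-identityˡ ε))

  cauchy-lipschitz₁ : ∀ x z K → 0ℚ < K → ∀ N → IsCauchy x →
    (∀ m n → N ℕ.≤ m → N ℕ.≤ n → ∣ z m - z n ∣ ≤ K * ∣ x m - x n ∣) →
    IsCauchy z
  cauchy-lipschitz₁ x z K 0<K N cx lip = cauchy-lipschitz x x z K 0<K N cx cx
    λ m n hm hn → ≤-trans (lip m n hm hn) (*-monoˡ (<⇒≤ 0<K)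
      (subst (_≤ ∣ x m - x n ∣ + ∣ x m - x n ∣) (ℚₚ.+-identityʳ _)
        (ℚₚ.+-monoʳ-≤ ∣ x m - x n ∣ (0≤∣∣ (x m - x n)))))

  cauchy-bounded : ∀ {x} → IsCauchy x →
    ∃[ M ] (0ℚ < M × ∃[ N ] (∀ n → N ℕ.≤ n → ∣ x n ∣ ≤ M))
  cauchy-bounded {x} cx =
    let N , p = cx 1ℚ 0<1
    in 1ℚ + ∣ x N ∣ , 0<+ 0<1 (0≤∣∣ (x N)) , N , λ n h → ≤-trans
      (subst (λ t → ∣ t ∣ ≤ ∣ x n - x N ∣ + ∣ x N ∣)
        (solve 2 (λ a b → (a :- b) :+ b := a) refl (x n) (x N))
        (ℚₚ.∣p+q∣≤∣p∣+∣q∣ (x n - x N) (x N)))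
      (ℚₚ.+-monoˡ-≤ ∣ x N ∣ (p n N h ℕₚ.≤-refl))

  cauchy-const : ∀ q → IsCauchy (λ _ → q)
  cauchy-const q ε 0<ε = 0 , λ _ _ _ _ →
    subst (λ t → ∣ t ∣ ≤ ε) (sym (ℚₚ.+-inverseʳ q)) (<⇒≤ 0<ε)

  cauchy-+ : ∀ {x y} → IsCauchy x → IsCauchy y → IsCauchy (λ n → x n + y n)
  cauchy-+ {x} {y} cx cy = cauchy-lipschitz x y (λ n → x n + y n) 1ℚ 0<1 0 cx cy λ m n _ _ →
    subst (∣ (x m + y m) - (x n + y n) ∣ ≤_) (sym (ℚₚ.*-identityˡ _))
      (subst (λ t → ∣ t ∣ ≤ ∣ x m - x n ∣ + ∣ y m - y n ∣)
        (solve 4 (λ a b c d → (a :- c) :+ (b :- d) := (a :+ b) :- (c :+ d))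
          refl (x m) (y m) (x n) (y n))
        (ℚₚ.∣p+q∣≤∣p∣+∣q∣ (x m - x n) (y m - y n)))

  cauchy-neg : ∀ {x} → IsCauchy x → IsCauchy (λ n → - x n)
  cauchy-neg {x} cx = cauchy-lipschitz₁ x (λ n → - x n) 1ℚ 0<1 0 cx λ m n _ _ →
    ≤-reflexive (trans (cong ∣_∣ (solve 2 (λ a b → :- a :- :- b := b :- a) refl (x m) (x n)))
      (trans (∣∣-comm (x n) (x m)) (sym (ℚₚ.*-identityˡ _))))

  cauchy-∣∣ : ∀ {x} → IsCauchy x → IsCauchy (λ n → ∣ x n ∣)
  cauchy-∣∣ {x} cx = cauchy-lipschitz₁ x (λ n → ∣ x n ∣) 1ℚ 0<1 0 cx λ m n _ _ →
    ≤-trans (∣∣-reverse (x m) (x n)) (≤-reflexive (sym (ℚₚ.*-identityˡ _)))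

  cauchy-* : ∀ {x y} → IsCauchy x → IsCauchy y → IsCauchy (λ n → x n * y n)
  cauchy-* {x} {y} cx cy =
    let A , 0<A , N₁ , p = cauchy-bounded cx
        B , 0<B , N₂ , q = cauchy-bounded cy
    in cauchy-lipschitz x y (λ n → x n * y n) (A + B) (0<+ 0<A (<⇒≤ 0<B)) (N₁ ℕ.⊔ N₂) cx cy λ m n hm hn →
      let u = ∣ x m - x n ∣
          v = ∣ y m - y n ∣ in
      ≤-trans (subst (λ t → ∣ t ∣ ≤ ∣ (x m - x n) * y m ∣ + ∣ x n * (y m - y n) ∣)
        (solve 4 (λ a b c d → (a :- c) :* b :+ c :* (b :- d) := a :* b :- c :* d)
          refl (x m) (y m) (x n) (y n))
        (ℚₚ.∣p+q∣≤∣p∣+∣q∣ ((x m - x n) * y m) (x n * (y m - y n))))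
      (≤-trans (+-mono-≤
          (≤-trans (≤-reflexive (ℚₚ.∣p*q∣≡∣p∣*∣q∣ (x m - x n) (y m)))
            (*-monoˡ (0≤∣∣ (x m - x n)) (q m (ℕₚ.≤-trans (ℕₚ.m≤n⊔m N₁ N₂) hm))))
          (≤-trans (≤-reflexive (ℚₚ.∣p*q∣≡∣p∣*∣q∣ (x n) (y m - y n)))
            (*-mono-≤ (0≤∣∣ (x n)) (0≤∣∣ (y m - y n))
              (p n (ℕₚ.≤-trans (ℕₚ.m≤m⊔n N₁ N₂) hn)) ≤-refl)))
        (0≤⇒≤ (subst (0ℚ ≤_)
          (solve 4 (λ a b u v → a :* u :+ b :* v := (a :+ b) :* (u :+ v) :- (u :* b :+ a :* v))
            refl A B u v)
          (0≤+ (0≤* (<⇒≤ 0<A) (0≤∣∣ (x m - x n))) (0≤* (<⇒≤ 0<B) (0≤∣∣ (y m - y n)))))))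

  cauchy-recip : ∀ {x} → IsCauchy x → ∀ δ → 0ℚ < δ → ∀ N → (∀ n → N ℕ.≤ n → δ ≤ x n) →
                 IsCauchy (λ n → recip (x n))
  cauchy-recip {x} cx δ 0<δ N δ≤x = cauchy-lipschitz₁ x (λ n → recip (x n)) (r * r) (0<* 0<r 0<r) N cx λ m n hm hn →
      ≤-trans (≤-reflexive (trans (cong ∣_∣ (recip-difference (0<x hm) (0<x hn)))
        (trans (ℚₚ.∣p*q∣≡∣p∣*∣q∣ (recip (x m) * recip (x n)) (x n - x m))
          (cong₂ _*_ (ℚₚ.0≤p⇒∣p∣≡p (0≤* (0≤r hm) (0≤r hn))) (∣∣-comm (x n) (x m))))))
        (*-mono-≤ (0≤* (0≤r hm) (0≤r hn)) (0≤∣∣ (x m - x n))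
          (*-mono-≤ (0≤r hm) (0≤r hn) (recip-anti 0<δ (δ≤x m hm)) (recip-anti 0<δ (δ≤x n hn)))
          ≤-refl)
    where
    r = recip δ
    0<r = 0<recip 0<δ
    0<x : ∀ {n} → N ℕ.≤ n → 0ℚ < x n
    0<x {n} hn = <-≤-trans 0<δ (δ≤x n hn)
    0≤r : ∀ {n} → N ℕ.≤ n → 0ℚ ≤ recip (x n)
    0≤r hn = <⇒≤ (0<recip (0<x hn))

  cauchy-null : ∀ {r} → (∀ n → 1 ℕ.≤ n → 0ℚ ≤ r n × r n ≤ recip (ℕ→ℚ n)) → IsCauchy r
  cauchy-null {r} h ε 0<ε =
    let N , 1≤N , N⁻¹≤ε = archimedean ε 0<ε
        le : ∀ n → N ℕ.≤ n → r n ≤ ε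
        le n N≤n = ≤-trans (proj₂ (h n (ℕₚ.≤-trans 1≤N N≤n)))
          (≤-trans (recip-anti (0<ℕ→ℚ 1≤N) (ℕ→ℚ-mono N≤n)) N⁻¹≤ε)
        ge : ∀ n → N ℕ.≤ n → 0ℚ ≤ r n
        ge n N≤n = proj₁ (h n (ℕₚ.≤-trans 1≤N N≤n))
    in N , λ m n hm hn → ∣-∣≤-between (ge m hm) (le m hm) (ge n hn) (le n hn)

  telescope : ∀ (z r : ℕ → ℚ) Q N → 0ℚ ≤ Q →
    (∀ k → N ℕ.≤ k → ∣ z (suc k) - z k ∣ ≤ Q * (r k - r (suc k))) →
    ∀ m n → N ℕ.≤ m → N ℕ.≤ n → ∣ z m - z n ∣ ≤ Q * ∣ r m - r n ∣
  telescope z r Q N 0≤Q step = go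
    where
    up′ : ∀ m n → N ℕ.≤ m → m ℕ.≤′ n → ∣ z n - z m ∣ ≤ Q * (r m - r n)
    up′ m .m hm (ℕ.≤′-reflexive refl) = ≤-reflexive
      (trans (cong ∣_∣ (ℚₚ.+-inverseʳ (z m)))
        (sym (trans (cong (Q *_) (ℚₚ.+-inverseʳ (r m))) (ℚₚ.*-zeroʳ Q))))
    up′ m (suc n) hm (ℕ.≤′-step m≤n) = ≤-trans (∣∣-triangle (z (suc n)) (z n) (z m))
      (≤-trans (+-mono-≤ (step n (ℕₚ.≤-trans hm (ℕₚ.≤′⇒≤ m≤n))) (up′ m n hm m≤n))
        (≤-reflexive (solve 4 (λ q a b c → q :* (b :- c) :+ q :* (a :- b) := q :* (a :- c))
          refl Q (r m) (r n) (r (suc n)))))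
    up : ∀ m n → N ℕ.≤ m → m ℕ.≤ n → ∣ z n - z m ∣ ≤ Q * ∣ r m - r n ∣
    up m n hm m≤n = ≤-trans (up′ m n hm (ℕₚ.≤⇒≤′ m≤n)) (*-monoˡ 0≤Q (p≤∣p∣ (r m - r n)))
    go : ∀ m n → N ℕ.≤ m → N ℕ.≤ n → ∣ z m - z n ∣ ≤ Q * ∣ r m - r n ∣
    go m n hm hn with ℕₚ.≤-total m n
    ... | inj₁ m≤n = subst (_≤ Q * ∣ r m - r n ∣) (∣∣-comm (z n) (z m)) (up m n hm m≤n)
    ... | inj₂ n≤m = subst (∣ z m - z n ∣ ≤_) (cong (Q *_) (∣∣-comm (r n) (r m))) (up n m hn n≤m)

  ∑ℚ-close : ∀ n f g c → (∀ i → i ℕ.< n → ∣ f i - g i ∣ ≤ c) →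
             ∣ ∑ℚ n f - ∑ℚ n g ∣ ≤ ℕ→ℚ n * c
  ∑ℚ-close zero    f g c h = ≤-reflexive (sym (ℚₚ.*-zeroˡ c))
  ∑ℚ-close (suc n) f g c h = ≤-trans
    (subst (λ t → ∣ t ∣ ≤ ∣ ∑ℚ n f - ∑ℚ n g ∣ + ∣ f n - g n ∣)
      (solve 4 (λ a b c d → (a :- b) :+ (c :- d) := (a :+ c) :- (b :+ d))
        refl (∑ℚ n f) (∑ℚ n g) (f n) (g n))
      (ℚₚ.∣p+q∣≤∣p∣+∣q∣ (∑ℚ n f - ∑ℚ n g) (f n - g n)))
    (≤-trans (+-mono-≤ (∑ℚ-close n f g c (λ i i<n → h i (ℕₚ.m<n⇒m<1+n i<n))) (h n ℕₚ.≤-refl))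
      (≤-reflexive (trans
        (solve 2 (λ m c → m :* c :+ c := (con 1ℚ :+ m) :* c) refl (ℕ→ℚ n) c)
        (cong (_* c) (sym (ℕ→ℚ-+ 1 n))))))

  ∑ℚ-double : ∀ n f → ∑ℚ (n ℕ.+ n) f ≡ ∑ℚ n (λ j → f (j ℕ.+ j) + f (suc (j ℕ.+ j)))
  ∑ℚ-double zero    f = refl
  ∑ℚ-double (suc n) f rewrite ℕₚ.+-suc n n = trans
    (ℚₚ.+-assoc (∑ℚ (n ℕ.+ n) f) (f (n ℕ.+ n)) (f (suc (n ℕ.+ n))))
    (cong (_+ (f (n ℕ.+ n) + f (suc (n ℕ.+ n)))) (∑ℚ-double n f))

  ----------------------------------------------------------------------

  1≤2^ : ∀ k → 1 ℕ.≤ 2 ℕ.^ k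
  1≤2^ k = ℕₚ.m^n>0 2 k

  n≤2^n : ∀ n → n ℕ.≤ 2 ℕ.^ n
  n≤2^n zero    = ℕ.z≤n
  n≤2^n (suc n) = ℕₚ.+-mono-≤ (1≤2^ n)
    (ℕₚ.≤-trans (n≤2^n n) (ℕₚ.≤-reflexive (sym (ℕₚ.+-identityʳ _))))

  mesh : ℕ → ℚ
  mesh k = recip (ℕ→ℚ (2 ℕ.^ k))

  0<mesh : ∀ k → 0ℚ < mesh k
  0<mesh k = 0<recip (0<ℕ→ℚ (1≤2^ k))

  mesh-inverse : ∀ k → ℕ→ℚ (2 ℕ.^ k) * mesh k ≡ 1ℚ
  mesh-inverse k = recip-inverse (0<ℕ→ℚ (1≤2^ k))

  2^-double : ∀ k → ℕ→ℚ (2 ℕ.^ suc k) ≡ ℕ→ℚ (2 ℕ.^ k) + ℕ→ℚ (2 ℕ.^ k)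
  2^-double k = trans (cong (λ t → ℕ→ℚ (2 ℕ.^ k ℕ.+ t)) (ℕₚ.+-identityʳ (2 ℕ.^ k)))
    (ℕ→ℚ-+ (2 ℕ.^ k) (2 ℕ.^ k))

  mesh-halves : ∀ k → mesh k ≡ mesh (suc k) + mesh (suc k)
  mesh-halves k = trans (sym (ℚₚ.*-identityʳ r))
    (trans (cong (r *_) (sym (trans (cong (_* r′) (sym (2^-double k))) (mesh-inverse (suc k)))))
    (trans (solve 3 (λ t r r′ → r :* ((t :+ t) :* r′) := (t :* r) :* (r′ :+ r′)) refl t r r′)
    (trans (cong (_* (r′ + r′)) (mesh-inverse k)) (ℚₚ.*-identityˡ (r′ + r′)))))
    where
    t  = ℕ→ℚ (2 ℕ.^ k)
    r  = mesh k
    r′ = mesh (suc k)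

  mesh-cauchy : IsCauchy mesh
  mesh-cauchy = cauchy-null λ n 1≤n →
    <⇒≤ (0<mesh n) , recip-anti (0<ℕ→ℚ 1≤n) (ℕ→ℚ-mono (n≤2^n n))

  node-bound : ∀ k j {x δ} → j ℕ.≤ 2 ℕ.^ k → δ ≤ x → δ ≤ 1ℚ →
               δ ≤ 1ℚ + ℕ→ℚ j * ((x - 1ℚ) * mesh k)
  node-bound k j {x} {δ} j≤ δ≤x δ≤1 = 0≤⇒≤ (subst (0ℚ ≤_)
    (solve 4 (λ d x j r → (con 1ℚ :- d) :* (con 1ℚ :- j :* r) :+ (j :* r) :* (x :- d)
        := (con 1ℚ :+ j :* ((x :- con 1ℚ) :* r)) :- d)
      refl δ x (ℕ→ℚ j) (mesh k))
    (0≤+ (0≤* (≤⇒0≤ δ≤1) (≤⇒0≤ jr≤1))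
      (0≤* (0≤* (0≤ℕ→ℚ j) (<⇒≤ (0<mesh k))) (≤⇒0≤ δ≤x))))
    where
    jr≤1 : ℕ→ℚ j * mesh k ≤ 1ℚ
    jr≤1 = subst (ℕ→ℚ j * mesh k ≤_) (mesh-inverse k)
      (*-mono-≤ (0≤ℕ→ℚ j) (<⇒≤ (0<mesh k)) (ℕ→ℚ-mono j≤) ≤-refl)

  private
    ∣*-≤ : ∀ {a b A B} → ∣ a ∣ ≤ A → ∣ b ∣ ≤ B → ∣ a * b ∣ ≤ A * B
    ∣*-≤ {a} {b} {A} {B} p q = subst (_≤ A * B) (sym (ℚₚ.∣p*q∣≡∣p∣*∣q∣ a b))
      (*-mono-≤ (0≤∣∣ a) (0≤∣∣ b) p q)

    ∣recip∣≤ : ∀ {δ a} → 0ℚ < δ → δ ≤ a → ∣ recip a ∣ ≤ recip δ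
    ∣recip∣≤ {δ} {a} 0<δ δ≤a = subst (_≤ recip δ)
      (sym (ℚₚ.0≤p⇒∣p∣≡p (<⇒≤ (0<recip (<-≤-trans 0<δ δ≤a))))) (recip-anti 0<δ δ≤a)

    ∣mesh∣≤ : ∀ k → ∣ mesh k ∣ ≤ mesh k
    ∣mesh∣≤ k = ≤-reflexive (ℚₚ.0≤p⇒∣p∣≡p (<⇒≤ (0<mesh k)))

  riemann-refine : ∀ k {x δ S} → 0ℚ < δ → δ ≤ x → δ ≤ 1ℚ → ∣ x - 1ℚ ∣ ≤ S →
    ∣ riemann (suc k) x - riemann k x ∣
      ≤ ((S * S) * (recip δ * recip δ)) * (mesh k - mesh (suc k))
  riemann-refine k {x} {δ} {S} 0<δ δ≤x δ≤1 ∣x-1∣≤S = ≤-trans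
      (subst (λ t → ∣ t - ∑ℚ T f ∣ ≤ ℕ→ℚ T * c) (sym split)
        (∑ℚ-close T (λ j → f′ (j ℕ.+ j) + f′ (suc (j ℕ.+ j))) f c pair))
      (subst₂ _≤_
        (solve 4 (λ t s d r → (t :* r) :* (((s :* s) :* (d :* d)) :* r)
            := t :* ((s :* r) :* ((d :* d) :* (s :* r))))
          refl (ℕ→ℚ T) S Δ r′)
        (trans (ℚₚ.*-identityˡ (Q * r′)) (cong (Q *_) (trans
          (solve 1 (λ r → r := (r :+ r) :- r) refl r′)
          (cong (_- r′) (sym (mesh-halves k))))))
        (*-mono-≤ (0≤* (0≤ℕ→ℚ T) (<⇒≤ 0<r′)) (0≤* 0≤Q (<⇒≤ 0<r′)) Tr′≤1 ≤-refl))
    where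
    T = 2 ℕ.^ k
    r = mesh k
    r′ = mesh (suc k)
    0<r′ = 0<mesh (suc k)
    Δ = recip δ
    w = (x - 1ℚ) * r
    w′ = (x - 1ℚ) * r′
    Q = (S * S) * (Δ * Δ)
    c = (S * r′) * ((Δ * Δ) * (S * r′))
    f f′ : ℕ → ℚ
    f  i = w  * recip (1ℚ + ℕ→ℚ (suc i) * w)
    f′ i = w′ * recip (1ℚ + ℕ→ℚ (suc i) * w′)
    0≤S : 0ℚ ≤ S
    0≤S = ≤-trans (0≤∣∣ (x - 1ℚ)) ∣x-1∣≤S
    0≤Δ : 0ℚ ≤ Δ
    0≤Δ = <⇒≤ (0<recip 0<δ)
    0≤Q : 0ℚ ≤ Q
    0≤Q = 0≤* (0≤* 0≤S 0≤S) (0≤* 0≤Δ 0≤Δ)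
    Tr′≤1 : ℕ→ℚ T * r′ ≤ 1ℚ
    Tr′≤1 = subst (ℕ→ℚ T * r′ ≤_) (mesh-inverse (suc k))
      (*-mono-≤ (0≤ℕ→ℚ T) (<⇒≤ 0<r′) (ℕ→ℚ-mono (ℕₚ.m≤m+n T (T ℕ.+ 0))) ≤-refl)
    split : ∑ℚ (2 ℕ.^ suc k) f′ ≡ ∑ℚ T (λ j → f′ (j ℕ.+ j) + f′ (suc (j ℕ.+ j)))
    split = trans (cong (λ t → ∑ℚ (T ℕ.+ t) f′) (ℕₚ.+-identityʳ T)) (∑ℚ-double T f′)
    ∣w′∣≤ : ∣ w′ ∣ ≤ S * r′
    ∣w′∣≤ = ∣*-≤ {x - 1ℚ} {r′} ∣x-1∣≤S (∣mesh∣≤ (suc k))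
    w≡ : w ≡ w′ + w′
    w≡ = trans (cong ((x - 1ℚ) *_) (mesh-halves k))
      (ℚₚ.*-distribˡ-+ (x - 1ℚ) r′ r′)
    pair : ∀ j → j ℕ.< T → ∣ (f′ (j ℕ.+ j) + f′ (suc (j ℕ.+ j))) - f j ∣ ≤ c
    pair j j<T = subst (λ t → ∣ t ∣ ≤ c) (sym difference)
      (∣*-≤ {w′} {(recip a * recip b) * w′} ∣w′∣≤
        (∣*-≤ {recip a * recip b} {w′}
          (∣*-≤ {recip a} {recip b} (∣recip∣≤ 0<δ δ≤a) (∣recip∣≤ 0<δ δ≤b)) ∣w′∣≤))
      where
      a = 1ℚ + ℕ→ℚ (suc (j ℕ.+ j)) * w′
      b = 1ℚ + ℕ→ℚ (suc (suc (j ℕ.+ j))) * w′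
      2j+2≤ : suc (suc (j ℕ.+ j)) ℕ.≤ 2 ℕ.^ suc k
      2j+2≤ = ℕₚ.≤-trans (ℕₚ.≤-reflexive (cong suc (sym (ℕₚ.+-suc j j))))
        (ℕₚ.+-mono-≤ j<T (ℕₚ.≤-trans j<T (ℕₚ.m≤m+n T 0)))
      δ≤a : δ ≤ a
      δ≤a = node-bound (suc k) (suc (j ℕ.+ j)) (ℕₚ.≤-trans (ℕₚ.n≤1+n _) 2j+2≤) δ≤x δ≤1
      δ≤b : δ ≤ b
      δ≤b = node-bound (suc k) (suc (suc (j ℕ.+ j))) 2j+2≤ δ≤x δ≤1
      b-a : b - a ≡ w′
      b-a = trans (cong (λ t → (1ℚ + t * w′) - a) (ℕ→ℚ-+ 1 (suc (j ℕ.+ j))))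
        (solve 2 (λ n w → (con 1ℚ :+ (con 1ℚ :+ n) :* w) :- (con 1ℚ :+ n :* w) := w)
          refl (ℕ→ℚ (suc (j ℕ.+ j))) w′)
      b≡ : 1ℚ + ℕ→ℚ (suc j) * w ≡ b
      b≡ = trans (cong (λ t → 1ℚ + ℕ→ℚ (suc j) * t) w≡)
        (trans (solve 2 (λ n w → con 1ℚ :+ n :* (w :+ w) := con 1ℚ :+ (n :+ n) :* w)
                 refl (ℕ→ℚ (suc j)) w′)
          (cong (λ t → 1ℚ + t * w′) (trans (sym (ℕ→ℚ-+ (suc j) (suc j)))
            (cong (λ t → ℕ→ℚ (suc t)) (ℕₚ.+-suc j j)))))
      difference : (f′ (j ℕ.+ j) + f′ (suc (j ℕ.+ j))) - f j ≡ w′ * ((recip a * recip b) * w′)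
      difference = trans
        (cong (λ t → (f′ (j ℕ.+ j) + f′ (suc (j ℕ.+ j))) - t)
          (cong₂ (λ s t → s * recip t) w≡ b≡))
        (trans (solve 3 (λ w p q → (w :* p :+ w :* q) :- (w :+ w) :* q := w :* (p :- q))
                 refl w′ (recip a) (recip b))
          (cong (w′ *_) (trans (recip-difference (<-≤-trans 0<δ δ≤a) (<-≤-trans 0<δ δ≤b))
            (cong ((recip a * recip b) *_) b-a))))

  riemann-lipschitz : ∀ k {x y δ} → 0ℚ < δ → δ ≤ x → δ ≤ y → δ ≤ 1ℚ →
    ∣ riemann k x - riemann k y ∣ ≤ (recip δ * recip δ) * ∣ x - y ∣
  riemann-lipschitz k {x} {y} {δ} 0<δ δ≤x δ≤y δ≤1 = ≤-trans
      (∑ℚ-close T (f x) (f y) c termwise)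
      (≤-reflexive (trans
        (solve 4 (λ t r d e → t :* (d :* (e :* r)) := (t :* r) :* (d :* e))
          refl (ℕ→ℚ T) r (Δ * Δ) ∣ x - y ∣)
        (trans (cong (_* ((Δ * Δ) * ∣ x - y ∣)) (mesh-inverse k)) (ℚₚ.*-identityˡ _))))
    where
    T = 2 ℕ.^ k
    r = mesh k
    Δ = recip δ
    f : ℚ → ℕ → ℚ
    f x i = ((x - 1ℚ) * r) * recip (1ℚ + ℕ→ℚ (suc i) * ((x - 1ℚ) * r))
    c = (Δ * Δ) * (∣ x - y ∣ * r)
    termwise : ∀ i → i ℕ.< T → ∣ f x i - f y i ∣ ≤ c
    termwise i i<T = subst (λ t → ∣ t ∣ ≤ c) (sym difference)
      (∣*-≤ {recip a * recip b} {(x - y) * r}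
        (∣*-≤ {recip a} {recip b} (∣recip∣≤ 0<δ δ≤a) (∣recip∣≤ 0<δ δ≤b))
        (∣*-≤ {x - y} {r} ≤-refl (∣mesh∣≤ k)))
      where
      u = (x - 1ℚ) * r
      v = (y - 1ℚ) * r
      n = ℕ→ℚ (suc i)
      a = 1ℚ + n * u
      b = 1ℚ + n * v
      δ≤a : δ ≤ a
      δ≤a = node-bound k (suc i) i<T δ≤x δ≤1
      δ≤b : δ ≤ b
      δ≤b = node-bound k (suc i) i<T δ≤y δ≤1
      difference : f x i - f y i ≡ (recip a * recip b) * ((x - y) * r)
      difference = trans
        (solve 4 (λ u v p q → u :* p :- v :* q := (u :* p) :* con 1ℚ :- (v :* q) :* con 1ℚ)
          refl u v (recip a) (recip b))
        (trans (cong₂ (λ s t → (u * recip a) * s - (v * recip b) * t)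
                 (sym (recip-inverse (<-≤-trans 0<δ δ≤b))) (sym (recip-inverse (<-≤-trans 0<δ δ≤a))))
          (solve 6 (λ x y r n p q →
              (((x :- con 1ℚ) :* r) :* p) :* ((con 1ℚ :+ n :* ((y :- con 1ℚ) :* r)) :* q)
                :- (((y :- con 1ℚ) :* r) :* q) :* ((con 1ℚ :+ n :* ((x :- con 1ℚ) :* r)) :* p)
              := (p :* q) :* ((x :- y) :* r))
            refl x y r n (recip a) (recip b)))

  riemann-cauchy : ∀ x → IsCauchy x → ∀ δ → 0ℚ < δ → ∀ N → (∀ n → N ℕ.≤ n → δ ≤ x n) →
                   IsCauchy (λ n → riemann n (x n))
  riemann-cauchy x cx δ₀ 0<δ₀ N₁ δ₀≤x =
    let S , 0<S , N₂ , bound = cauchy-bounded {λ n → x n - 1ℚ} (cauchy-+ {x} cx (cauchy-const (- 1ℚ)))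
        Q = (S * S) * D
        0<Q = 0<* (0<* 0<S 0<S) 0<D
    in cauchy-lipschitz x mesh (λ n → riemann n (x n)) (D + Q) (0<+ 0<D (<⇒≤ 0<Q)) (N₁ ℕ.⊔ N₂)
      cx mesh-cauchy λ m n hm hn →
        let δ≤xm = δ≤x m (ℕₚ.≤-trans (ℕₚ.m≤m⊔n N₁ N₂) hm)
            δ≤xn = δ≤x n (ℕₚ.≤-trans (ℕₚ.m≤m⊔n N₁ N₂) hn)
            u = ∣ x m - x n ∣
            v = ∣ mesh m - mesh n ∣ in
        ≤-trans (∣∣-triangle (riemann m (x m)) (riemann m (x n)) (riemann n (x n)))
        (≤-trans (+-mono-≤ (riemann-lipschitz m 0<δ δ≤xm δ≤xn δ≤1)
            (telescope (λ k → riemann k (x n)) mesh Q 0 (<⇒≤ 0<Q)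
              (λ k _ → riemann-refine k 0<δ δ≤xn δ≤1
                (bound n (ℕₚ.≤-trans (ℕₚ.m≤n⊔m N₁ N₂) hn)))
              m n ℕ.z≤n ℕ.z≤n))
          (0≤⇒≤ (subst (0ℚ ≤_)
            (solve 4 (λ a b u v → a :* v :+ b :* u := (a :+ b) :* (u :+ v) :- (a :* u :+ b :* v))
              refl D Q u v)
            (0≤+ (0≤* (<⇒≤ 0<D) (0≤∣∣ (mesh m - mesh n)))
                 (0≤* (<⇒≤ 0<Q) (0≤∣∣ (x m - x n)))))))
    where
    δ = δ₀ Rat.⊓ 1ℚ
    δ≤1 : δ ≤ 1ℚ
    δ≤1 = ℚₚ.p⊓q≤q δ₀ 1ℚ
    0<δ : 0ℚ < δ
    0<δ with ℚₚ.≤-total δ₀ 1ℚ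
    ... | inj₁ le = subst (0ℚ <_) (sym (ℚₚ.p≤q⇒p⊓q≡p le)) 0<δ₀
    ... | inj₂ ge = subst (0ℚ <_) (sym (ℚₚ.p≥q⇒p⊓q≡q ge)) 0<1
    δ≤x : ∀ n → N₁ ℕ.≤ n → δ ≤ x n
    δ≤x n hn = ≤-trans (ℚₚ.p⊓q≤p δ₀ 1ℚ) (δ₀≤x n hn)
    D = recip δ * recip δ
    0<D = 0<* (0<recip 0<δ) (0<recip 0<δ)

  ----------------------------------------------------------------------

  ζ-step : ∀ s → 1 ℕ.< s → ∀ k → 1 ℕ.≤ k →
    ∣ ζ-partial s (suc k) - ζ-partial s k ∣ ≤ 1ℚ * (recip (ℕ→ℚ k) - recip (ℕ→ℚ (suc k)))
  ζ-step s 1<s k 1≤k = ≤-trans (≤-reflexive (trans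
      (cong ∣_∣ (solve 2 (λ a b → (a :+ b) :- a := b) refl (ζ-partial s k) t))
      (ℚₚ.0≤p⇒∣p∣≡p (<⇒≤ (0<recip (0<ℕ→ℚ (ℕₚ.m^n>0 (suc k) s)))))))
    (≤-trans (recip-anti 0<kk′ (ℕ→ℚ-mono le)) (≤-reflexive e))
    where
    t = recip (ℕ→ℚ (suc k ℕ.^ s))
    0<k = 0<ℕ→ℚ 1≤k
    0<k′ = 0<ℕ→ℚ {suc k} (ℕ.s≤s ℕ.z≤n)
    0<kk′ = 0<ℕ→ℚ {k ℕ.* suc k} (ℕₚ.*-mono-≤ 1≤k (ℕ.s≤s (ℕ.z≤n {k})))
    le : k ℕ.* suc k ℕ.≤ suc k ℕ.^ s
    le = ℕₚ.≤-trans (ℕₚ.*-mono-≤ (ℕₚ.n≤1+n k)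
        (ℕₚ.≤-reflexive (sym (ℕₚ.*-identityʳ (suc k)))))
      (ℕₚ.^-monoʳ-≤ (suc k) 1<s)
    K = ℕ→ℚ k
    K′ = ℕ→ℚ (suc k)
    P = ℕ→ℚ (k ℕ.* suc k)
    e : recip P ≡ 1ℚ * (recip K - recip K′)
    e = trans (sym (ℚₚ.*-identityʳ (recip P)))
      (trans (cong (recip P *_) (sym (trans (cong₂ _*_ (recip-inverse 0<k) (recip-inverse 0<k′)) refl)))
      (trans (solve 5 (λ r a b p q → r :* ((a :* p) :* (b :* q)) := ((a :* b) :* r) :* (p :* q))
               refl (recip P) K K′ (recip K) (recip K′))
      (trans (cong (λ t → (t * recip P) * (recip K * recip K′)) (sym (ℕ→ℚ-* k (suc k))))
      (trans (cong (_* (recip K * recip K′)) (recip-inverse 0<kk′))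
        (cong (1ℚ *_) (sym (trans (recip-difference 0<k 0<k′)
          (trans (cong ((recip K * recip K′) *_)
            (trans (cong (_- K) (ℕ→ℚ-+ 1 k)) (solve 1 (λ a → (con 1ℚ :+ a) :- a := con 1ℚ) refl K)))
            (ℚₚ.*-identityʳ (recip K * recip K′))))))))))

  ζ-cauchy : ∀ s → 1 ℕ.< s → IsCauchy (ζ-partial s)
  ζ-cauchy s 1<s = cauchy-lipschitz₁ (λ n → recip (ℕ→ℚ n)) (ζ-partial s) 1ℚ 0<1 1
    (cauchy-null λ n 1≤n → <⇒≤ (0<recip (0<ℕ→ℚ 1≤n)) , ≤-refl)
    (telescope (ζ-partial s) (λ n → recip (ℕ→ℚ n)) 1ℚ 1 (<⇒≤ 0<1) (ζ-step s 1<s))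

  1≤ζ-partial : ∀ s n → 1 ℕ.≤ n → 1ℚ ≤ ζ-partial s n
  1≤ζ-partial s (suc zero) _ = ≤-reflexive (sym (trans (ℚₚ.+-identityˡ _)
    (cong (λ t → recip (ℕ→ℚ t)) (ℕₚ.^-zeroˡ s))))
  1≤ζ-partial s (suc (suc n)) _ = subst (_≤ ζ-partial s (suc (suc n))) (ℚₚ.+-identityʳ 1ℚ)
    (+-mono-≤ (1≤ζ-partial s (suc n) (ℕ.s≤s ℕ.z≤n))
      (<⇒≤ (0<recip (0<ℕ→ℚ (ℕₚ.m^n>0 (suc (suc n)) s)))))

------------------------------------------------------------------------
-- Real numbers: Cauchy sequences of rationals with pointwise operations,
-- identified only through _≤_ (two reals are equal when x ≤ y and y ≤ x)

record ℝ : Set where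
  constructor real
  field
    seq    : ℕ → ℚ
    cauchy : IsCauchy seq

open ℝ public

infix  4 _≤_ _<_
infixl 6 _+_ _-_
infixl 7 _*_ _÷_⟨_⟩

_≤_ : ℝ → ℝ → Set
x ≤ y = ∀ ε → 0ℚ Rat.< ε → ∃[ N ] (∀ n → N ℕ.≤ n → seq x n Rat.≤ seq y n Rat.+ ε)

_<_ : ℝ → ℝ → Set
x < y = ∃[ δ ] (0ℚ Rat.< δ × ∃[ N ] (∀ n → N ℕ.≤ n → seq x n Rat.+ δ Rat.≤ seq y n))

fromℕ : ℕ → ℝ
fromℕ n = real (λ _ → ℕ→ℚ n) (RationalLemmas.cauchy-const (ℕ→ℚ n))

_+_ _*_ _-_ : ℝ → ℝ → ℝ
x + y = real (λ n → seq x n Rat.+ seq y n) (RationalLemmas.cauchy-+ {seq x} {seq y} (cauchy x) (cauchy y))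
x * y = real (λ n → seq x n Rat.* seq y n) (RationalLemmas.cauchy-* {seq x} {seq y} (cauchy x) (cauchy y))
x - y = real (λ n → seq x n Rat.- seq y n)
  (RationalLemmas.cauchy-+ {seq x} {λ n → Rat.- seq y n} (cauchy x)
    (RationalLemmas.cauchy-neg {seq y} (cauchy y)))

∣_∣ : ℝ → ℝ
∣ x ∣ = real (λ n → Rat.∣ seq x n ∣) (RationalLemmas.cauchy-∣∣ {seq x} (cauchy x))

0<⇒eventually : ∀ x → fromℕ 0 < x →
  ∃[ δ ] (0ℚ Rat.< δ × ∃[ N ] (∀ n → N ℕ.≤ n → δ Rat.≤ seq x n))
0<⇒eventually x (δ , 0<δ , N , h) =
  δ , 0<δ , N , λ n hn → subst (Rat._≤ seq x n) (ℚₚ.+-identityˡ δ) (h n hn)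

_÷_⟨_⟩ : (x y : ℝ) → fromℕ 0 < y → ℝ
x ÷ y ⟨ 0<y ⟩ = x * real (λ n → recip (seq y n))
  (let δ , 0<δ , N , h = 0<⇒eventually y 0<y
   in RationalLemmas.cauchy-recip {seq y} (cauchy y) δ 0<δ N h)

∑[1⋯_] : ℕ → (ℕ → ℝ) → ℝ
∑[1⋯ zero  ] f = fromℕ 0
∑[1⋯ suc n ] f = ∑[1⋯ n ] f + f (suc n)

-- ζ(s) = Σ_{n ≥ 1} n⁻ˢ at an integer s ≥ 2.
ζ : (s : ℕ) → 1 ℕ.< s → ℝ
ζ s 1<s = real (ζ-partial s) (RationalLemmas.ζ-cauchy s 1<s)

-- The natural logarithm ∫₁ˣ dt/t, as the limit of Riemann sums in which the
-- mesh and the rational approximation to x are refined together.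
log : (x : ℝ) → fromℕ 0 < x → ℝ
log x 0<x = real (λ n → riemann n (seq x n))
  (let δ , 0<δ , N , h = 0<⇒eventually x 0<x
   in RationalLemmas.riemann-cauchy (seq x) (cauchy x) δ 0<δ N h)

------------------------------------------------------------------------

0<fromℕ : ∀ n → 1 ℕ.≤ n → fromℕ 0 < fromℕ n
0<fromℕ n 1≤n = 1ℚ , RationalLemmas.0<1 , 0 , λ _ _ → subst (Rat._≤ ℕ→ℚ n)
  (sym (ℚₚ.+-identityˡ 1ℚ)) (RationalLemmas.ℕ→ℚ-mono 1≤n)

0<* : ∀ x y → fromℕ 0 < x → fromℕ 0 < y → fromℕ 0 < x * y
0<* x y 0<x 0<y =
  let α , 0<α , N , p = 0<⇒eventually x 0<x
      β , 0<β , M , q = 0<⇒eventually y 0<y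
  in α Rat.* β , RationalLemmas.0<* 0<α 0<β , N ℕ.⊔ M , λ n hn →
    subst (Rat._≤ seq x n Rat.* seq y n) (sym (ℚₚ.+-identityˡ _))
      (RationalLemmas.*-mono-≤ (ℚₚ.<⇒≤ 0<α) (ℚₚ.<⇒≤ 0<β)
        (p n (ℕₚ.≤-trans (ℕₚ.m≤m⊔n N M) hn)) (q n (ℕₚ.≤-trans (ℕₚ.m≤n⊔m N M) hn)))

0<ζ : ∀ s (1<s : 1 ℕ.< s) → fromℕ 0 < ζ s 1<s
0<ζ s 1<s = 1ℚ , RationalLemmas.0<1 , 1 , λ n 1≤n → subst (Rat._≤ ζ-partial s n)
  (sym (ℚₚ.+-identityˡ 1ℚ)) (RationalLemmas.1≤ζ-partial s n 1≤n)

0<6ζ : ∀ s (1<s : 1 ℕ.< s) → fromℕ 0 < fromℕ 6 * ζ s 1<s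
0<6ζ s 1<s = 0<* (fromℕ 6) (ζ s 1<s) (0<fromℕ 6 (ℕ.s≤s ℕ.z≤n)) (0<ζ s 1<s)

1<2b : ∀ {b} → 3 ℕ.< b → 1 ℕ.< 2 ℕ.* b
1<2b {b} 3<b = ℕₚ.≤-trans (ℕ.s≤s (ℕ.s≤s ℕ.z≤n)) (ℕₚ.≤-trans 3<b (ℕₚ.m≤n*m b 2))

1<2b-1 : ∀ {b} → 3 ℕ.< b → 1 ℕ.< 2 ℕ.* b ℕ.∸ 1
1<2b-1 {b} 3<b = ℕₚ.∸-monoˡ-≤ 1
  (ℕₚ.≤-trans (ℕ.s≤s (ℕ.s≤s (ℕ.s≤s ℕ.z≤n))) (ℕₚ.≤-trans 3<b (ℕₚ.m≤n*m b 2)))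

module Submission where

-- Write gcd_b(j, n) = ∑ φ(d) over the d with d^b ∣ j and d^b ∣ n. Then h_b(n) = ∑_{d^b ∣ n} φ(d) n / d^b, so
-- with y = x / d^b the weighted sum splits into ∑_d φ(d) ∑_{m ≤ y} m (1 − m / y). The inner sum is
-- y² / 6 + O(y), for small y too, so the full series ∑_d φ(d) d^{-2b} = ζ(2b − 1) / ζ(2b) appears at once,
-- with total error O(x ∑_d |φ(d)| d^{-b}) = O(x) as b > 3; here |φ(d)| ≤ d² is all that is needed of φ.
-- Each estimate is carried out on the k-th rational approximations, with both zeta series and the sum
-- over d cut at k; the discrepancy between the cut series is at most 4 / k.

open import Defs hiding (_≤_; _<_; _+_; _*_; _-_; ∣_∣; 0<*)
open import Data.List using (map; filter; upTo; []; _∷_)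
open import Data.List.Extrema.Nat using (xs≤max; ⊥≤max; argmax-sel)
open import Data.List.Membership.Propositional.Properties using (∈-filter⁺; ∈-filter⁻; ∈-map⁺; ∈-upTo⁺)
open import Data.List.Properties using (upTo-∷ʳ; map-++)
open import Data.List.Relation.Unary.All using (lookup)
open import Data.Nat as ℕ using (ℕ; zero; suc; NonZero)
open import Data.Nat.Coprimality using (Coprime; coprime-divisor; GCD≡1⇒coprime)
open import Data.Nat.Divisibility
open import Data.Nat.GCD using (GCD; gcd; gcd-GCD; GCD-*; gcd[m,n]∣m; gcd[m,n]∣n; gcd[m,n]≢0)
open import Data.Nat.Induction using (<-rec)
open import Data.Nat.ListAction using (sum)
open import Data.Nat.ListAction.Properties using (sum-++)
import Data.Nat.Properties as ℕₚ
open import Data.Product using (∃-syntax; _×_; _,_; proj₁; proj₂)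
open import Data.Rational as Rat using (ℚ; 0ℚ; 1ℚ)
import Data.Rational.Properties as ℚₚ
open import Data.Sum using (inj₁; inj₂)
open import Function using (id)
open import Relation.Nullary using (Dec; yes; no; ¬_; contradiction; _×-dec_)
open import Relation.Binary.PropositionalEquality
  using (_≡_; refl; sym; trans; cong; cong₂; subst; subst₂)

-- Since `_≤_` on `ℝ` asks for an inequality only up to ε at all late indices k, the theorem reduces
-- to a rational inequality at index k whose extra error vanishes as k grows. The price: N ≤ x < N +
-- 1 reaches the k-th approximation q of x only as N ≤ q + 1 and q ≤ N + 1, so N need not be the
-- floor of q, and every elementary estimate has to tolerate a deviation of 1 on either side. A
-- factor 6 stands in front of the sums so that the power-sum formulas have integer coefficients; it
-- is given up at the end through |p| ≤ |6p|. The constant 104 is 13 · 2 · 2 · 2: 13 and one 2 come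
-- from the inner sum over m, another 2 bounds ζ(2) in the sum over d, and the last turns O(x) into
-- O(x log x), because log q ≥ 1/2 once q ≥ 2.

module Arithmetic where
  open import Data.Nat using (_+_; _*_; _^_; _≤_; z≤n)
  open import Data.Nat.Solver using (module +-*-Solver)
  open +-*-Solver using (solve; _:*_; _:=_)

  -- Powers, coprimality and the generalized gcd.

  ^-distribʳ-* : ∀ k m n → (m * n) ^ k ≡ m ^ k * n ^ k
  ^-distribʳ-* zero    m n = refl
  ^-distribʳ-* (suc k) m n = trans (cong (m * n *_) (^-distribʳ-* k m n))
    (solve 4 (λ m n a b → m :* n :* (a :* b) := m :* a :* (n :* b)) refl m n (m ^ k) (n ^ k))

  n≤n^suc : ∀ k n → n ≤ n ^ suc k
  n≤n^suc k zero    = z≤n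
  n≤n^suc k (suc n) = ℕₚ.m≤m*n (suc n) (suc n ^ k) {{ℕₚ.m^n≢0 (suc n) k}}

  coprime-^ʳ : ∀ {m n} k → Coprime m n → Coprime m (n ^ k)
  coprime-^ʳ zero    c (_   , d∣1)    = ∣1⇒≡1 d∣1
  coprime-^ʳ (suc k) c (d∣m , d∣n*nᵏ) = coprime-^ʳ k c
    (d∣m , coprime-divisor (λ (e∣d , e∣n) → c (∣-trans e∣d d∣m , e∣n)) d∣n*nᵏ)

  coprime-^ : ∀ {m n} k → Coprime m n → Coprime (m ^ k) (n ^ k)
  coprime-^ k c (d∣mᵏ , d∣nᵏ) =
    coprime-^ʳ k (λ (e∣nᵏ , e∣m) → coprime-^ʳ k c (e∣m , e∣nᵏ)) (d∣nᵏ , d∣mᵏ)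

  coprime-*-∣ : ∀ {m n j} → Coprime m n → m ∣ j → n ∣ j → m * n ∣ j
  coprime-*-∣ {m} {n} c m∣j (divides t refl) =
    *-monoˡ-∣ n (coprime-divisor c (subst (m ∣_) (ℕₚ.*-comm t n) m∣j))

  -- lcm (d , e) = q * e, and the e ^ b that divide j are closed under lcm.
  lcm-^-∣ : ∀ b d e .{{_ : NonZero e}} → ∃[ q ] (d ∣ q * e ×
            (∀ {j} → d ^ b ∣ j → e ^ b ∣ j → (q * e) ^ b ∣ j))
  lcm-^-∣ b d e with gcd d e | gcd[m,n]∣m d e | gcd[m,n]∣n d e | gcd-GCD d e
                   | gcd[m,n]≢0 d e (inj₂ (ℕ.≢-nonZero⁻¹ e))
  ... | g | divides p refl | divides q refl | isGCD | g≢0 =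
    p , ∣-trans (m∣m*n q) (∣-reflexive (solve 3 (λ p q g → p :* g :* q := p :* (q :* g)) refl p q g)) ,
    λ {j} → common {j}
    where
    instance
      nz : NonZero g
      nz = ℕ.≢-nonZero g≢0
      nzᵇ : NonZero (g ^ b)
      nzᵇ = ℕₚ.m^n≢0 g b
    c : Coprime p q
    c = GCD≡1⇒coprime (GCD-* (subst (GCD (p * g) (q * g)) (sym (ℕₚ.*-identityˡ g)) isGCD))
    common : ∀ {j} → (p * g) ^ b ∣ j → (q * g) ^ b ∣ j → (p * (q * g)) ^ b ∣ j
    -- With j = i * g ^ b, cancelling g ^ b leaves the coprime numbers p ^ b and q ^ b, both
    -- dividing i, so their product divides i.
    common {j} h₁ h₂ with ∣-trans (subst (g ^ b ∣_) (sym (^-distribʳ-* b q g)) (n∣m*n (q ^ b))) h₂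
    ... | divides i refl = subst (_∣ i * g ^ b)
      (trans (cong (_* g ^ b) (sym (^-distribʳ-* b p q)))
        (trans (sym (^-distribʳ-* b (p * q) g)) (cong (_^ b) (ℕₚ.*-assoc p q g))))
      (*-monoˡ-∣ (g ^ b) (coprime-*-∣ (coprime-^ b c)
        (*-cancelʳ-∣ {n = i} (g ^ b) (subst (_∣ i * g ^ b) (^-distribʳ-* b p g) h₁))
        (*-cancelʳ-∣ {n = i} (g ^ b) (subst (_∣ i * g ^ b) (^-distribʳ-* b q g) h₂))))

  module _ (b′ j′ n : ℕ) where
    private
      b = suc b′
      j = suc j′
      G = gcd[ b ] j n
      Common? : ∀ d → Dec (d ^ b ∣ j × d ^ b ∣ n)
      Common? d = (d ^ b ∣? j) ×-dec (d ^ b ∣? n)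
      common = filter Common? [1⋯ j ]

    1≤gcd[] : 1 ≤ G
    1≤gcd[] = ⊥≤max 1 common

    gcd[]-common : G ^ b ∣ j × G ^ b ∣ n
    gcd[]-common with G | argmax-sel id 1 common
    -- The maximum is either the default 1, which is always common, or one of the filtered
    -- candidates.
    ... | _ | inj₁ refl = subst (λ t → t ∣ j × t ∣ n) (sym (ℕₚ.^-zeroˡ b)) (1∣ j , 1∣ n)
    ... | _ | inj₂ G∈   = proj₂ (∈-filter⁻ Common? {xs = [1⋯ j ]} G∈)

    ^∣⇒≤ : ∀ {d} → d ^ b ∣ j → d ≤ j
    ^∣⇒≤ {d} h = ℕₚ.≤-trans (n≤n^suc b′ d) (∣⇒≤ h)

    gcd[]≤ : G ≤ j
    gcd[]≤ = ^∣⇒≤ (proj₁ gcd[]-common)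

    common≤gcd[] : ∀ {d} → d ^ b ∣ j → d ^ b ∣ n → d ≤ G
    common≤gcd[] {zero}  _   _   = z≤n
    common≤gcd[] {suc d} d∣j d∣n = lookup (xs≤max 1 common)
      (∈-filter⁺ Common? (∈-map⁺ suc (∈-upTo⁺ (^∣⇒≤ d∣j))) (d∣j , d∣n))

    -- Maximality is upgraded to divisibility: the lcm of d and G is again admissible, hence at most
    -- G, but it is a multiple q * G. As j is positive, q is not 0, so q = 1 and d divides G.
    common∣gcd[] : ∀ {d} → d ^ b ∣ j → d ^ b ∣ n → d ∣ G
    common∣gcd[] {d} d∣j d∣n with lcm-^-∣ b d G {{ℕ.>-nonZero 1≤gcd[]}}
    ... | q , d∣qG , lcm∣ = go q d∣qG
        (lcm∣ d∣j (proj₁ gcd[]-common)) (common≤gcd[] (lcm∣ d∣j (proj₁ gcd[]-common)) (lcm∣ d∣n (proj₂ gcd[]-common)))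
      where
      go : ∀ q → d ∣ q * G → (q * G) ^ b ∣ j → q * G ≤ G → d ∣ G
      go 0             _ 0∣j _ = contradiction (0∣⇒≡0 0∣j) λ ()
      go 1             h _ _ = subst (d ∣_) (ℕₚ.*-identityˡ G) h
      go (suc (suc q)) _ _ h = contradiction h (ℕₚ.<⇒≱
        (ℕₚ.+-mono-≤ 1≤gcd[] (ℕₚ.m≤m+n G (q * G))))

    ∣gcd[]⇒common : ∀ {d} → d ∣ G → d ^ b ∣ j × d ^ b ∣ n
    ∣gcd[]⇒common {d} (divides q e) = ∣-trans dᵇ∣Gᵇ (proj₁ gcd[]-common) , ∣-trans dᵇ∣Gᵇ (proj₂ gcd[]-common)
      where
      dᵇ∣Gᵇ : d ^ b ∣ G ^ b
      dᵇ∣Gᵇ = subst (d ^ b ∣_) (trans (sym (^-distribʳ-* b q d)) (cong (_^ b) (sym e))) (n∣m*n (q ^ b))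

module Rationals where
  open Rat using (_+_; _*_; _-_; -_; ∣_∣; _≤_; _<_)
  open import Data.Rational.Solver using (module +-*-Solver)
  open ℚₚ using (≤-refl; ≤-trans; ≤-reflexive; <⇒≤; <-≤-trans; +-mono-≤)
  open RationalLemmas
  open Arithmetic
  open +-*-Solver using (solve; _:+_; _:*_; _:-_; :-_; _:=_; con)

  -- Finite sums of rationals and indicators of divisibility.

  ∣*∣≤ : ∀ {a b A B} → ∣ a ∣ ≤ A → ∣ b ∣ ≤ B → ∣ a * b ∣ ≤ A * B
  ∣*∣≤ {a} {b} {A} {B} p q = subst (_≤ A * B) (sym (ℚₚ.∣p*q∣≡∣p∣*∣q∣ a b))
    (*-mono-≤ (0≤∣∣ a) (0≤∣∣ b) p q)

  ∣+∣≤ : ∀ {a b A B} → ∣ a ∣ ≤ A → ∣ b ∣ ≤ B → ∣ a + b ∣ ≤ A + B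
  ∣+∣≤ {a} {b} p q = ≤-trans (ℚₚ.∣p+q∣≤∣p∣+∣q∣ a b) (+-mono-≤ p q)

  0≤⇒∣∣≤ : ∀ {p q} → 0ℚ ≤ p → p ≤ q → ∣ p ∣ ≤ q
  0≤⇒∣∣≤ 0≤p p≤q = ≤-trans (≤-reflexive (ℚₚ.0≤p⇒∣p∣≡p 0≤p)) p≤q

  *-monoʳ : ∀ {a c d} → 0ℚ ≤ a → c ≤ d → c * a ≤ d * a
  *-monoʳ {a} 0≤a = ℚₚ.*-monoʳ-≤-nonNeg a {{Rat.nonNegative 0≤a}}

  ∑ℚ-cong : ∀ n {f g} → (∀ i → i ℕ.< n → f i ≡ g i) → ∑ℚ n f ≡ ∑ℚ n g
  ∑ℚ-cong zero    h = refl
  ∑ℚ-cong (suc n) h = cong₂ _+_ (∑ℚ-cong n λ i i<n → h i (ℕₚ.m<n⇒m<1+n i<n)) (h n ℕₚ.≤-refl)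

  ∑ℚ-*ˡ : ∀ n c f → ∑ℚ n (λ i → c * f i) ≡ c * ∑ℚ n f
  ∑ℚ-*ˡ zero    c f = sym (ℚₚ.*-zeroʳ c)
  ∑ℚ-*ˡ (suc n) c f = trans (cong (_+ c * f n) (∑ℚ-*ˡ n c f))
    (sym (ℚₚ.*-distribˡ-+ c (∑ℚ n f) (f n)))

  ∑ℚ-+ : ∀ n f g → ∑ℚ n (λ i → f i + g i) ≡ ∑ℚ n f + ∑ℚ n g
  ∑ℚ-+ zero    f g = refl
  ∑ℚ-+ (suc n) f g = trans (cong (_+ (f n + g n)) (∑ℚ-+ n f g))
    (solve 4 (λ a b c d → (a :+ b) :+ (c :+ d) := (a :+ c) :+ (b :+ d)) refl
      (∑ℚ n f) (∑ℚ n g) (f n) (g n))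

  ∑ℚ-0 : ∀ n → ∑ℚ n (λ _ → 0ℚ) ≡ 0ℚ
  ∑ℚ-0 zero    = refl
  ∑ℚ-0 (suc n) = cong (_+ 0ℚ) (∑ℚ-0 n)

  ∑ℚ-const : ∀ n c → ∑ℚ n (λ _ → c) ≡ ℕ→ℚ n * c
  ∑ℚ-const zero    c = sym (ℚₚ.*-zeroˡ c)
  ∑ℚ-const (suc n) c = trans (cong (_+ c) (∑ℚ-const n c))
    (trans (solve 2 (λ m c → m :* c :+ c := (con 1ℚ :+ m) :* c) refl (ℕ→ℚ n) c)
      (cong (_* c) (sym (ℕ→ℚ-+ 1 n))))

  ∑ℚ-swap : ∀ m n (f : ℕ → ℕ → ℚ) →
            ∑ℚ m (λ i → ∑ℚ n (f i)) ≡ ∑ℚ n (λ j → ∑ℚ m (λ i → f i j))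
  ∑ℚ-swap zero    n f = sym (∑ℚ-0 n)
  ∑ℚ-swap (suc m) n f = trans (cong (_+ ∑ℚ n (f m)) (∑ℚ-swap m n f))
    (sym (∑ℚ-+ n (λ j → ∑ℚ m (λ i → f i j)) (f m)))

  ∑ℚ-∣∣ : ∀ n {f g} → (∀ i → i ℕ.< n → ∣ f i ∣ ≤ g i) → ∣ ∑ℚ n f ∣ ≤ ∑ℚ n g
  ∑ℚ-∣∣ zero    h = ≤-refl
  ∑ℚ-∣∣ (suc n) {f} h = ∣+∣≤ {∑ℚ n f} (∑ℚ-∣∣ n λ i i<n → h i (ℕₚ.m<n⇒m<1+n i<n)) (h n ℕₚ.≤-refl)

  ∑ℚ-mono : ∀ n {f g} → (∀ i → i ℕ.< n → f i ≤ g i) → ∑ℚ n f ≤ ∑ℚ n g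
  ∑ℚ-mono zero    h = ≤-refl
  ∑ℚ-mono (suc n) h = +-mono-≤ (∑ℚ-mono n λ i i<n → h i (ℕₚ.m<n⇒m<1+n i<n)) (h n ℕₚ.≤-refl)

  ∑ℚ-truncate : ∀ {m n} f → m ℕ.≤ n → (∀ i → m ℕ.≤ i → f i ≡ 0ℚ) → ∑ℚ n f ≡ ∑ℚ m f
  ∑ℚ-truncate {m} f m≤n h = go (ℕₚ.≤⇒≤′ m≤n)
    where
    go : ∀ {n} → m ℕ.≤′ n → ∑ℚ n f ≡ ∑ℚ m f
    go (ℕ.≤′-reflexive refl)  = refl
    go {suc n} (ℕ.≤′-step le) = trans (cong₂ _+_ (go le) (h n (ℕₚ.≤′⇒≤ le))) (ℚₚ.+-identityʳ _)

  ∑ℚ-list-sum : ∀ n (g : ℕ → ℕ) → ℕ→ℚ (sum (map g [1⋯ n ])) ≡ ∑ℚ n (λ i → ℕ→ℚ (g (suc i)))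
  ∑ℚ-list-sum zero    g = refl
  ∑ℚ-list-sum (suc n) g = trans (cong ℕ→ℚ step)
    (trans (ℕ→ℚ-+ (sum (map g [1⋯ n ])) (g (suc n))) (cong (_+ ℕ→ℚ (g (suc n))) (∑ℚ-list-sum n g)))
    where
    step : sum (map g [1⋯ suc n ]) ≡ sum (map g [1⋯ n ]) ℕ.+ g (suc n)
    step = trans (cong (λ t → sum (map g (map suc t))) (sym (upTo-∷ʳ n)))
      (trans (cong (λ t → sum (map g t)) (map-++ suc (upTo n) (n ∷ [])))
      (trans (cong sum (map-++ g [1⋯ n ] (suc n ∷ [])))
      (trans (sum-++ (map g [1⋯ n ]) (g (suc n) ∷ []))
        (cong (sum (map g [1⋯ n ]) ℕ.+_) (ℕₚ.+-identityʳ (g (suc n)))))))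

  𝟙 : ∀ {A : Set} → Dec A → ℚ
  𝟙 (yes _) = 1ℚ
  𝟙 (no  _) = 0ℚ

  𝟙-yes : ∀ {A : Set} (d : Dec A) → A → 𝟙 d ≡ 1ℚ
  𝟙-yes (yes _) _ = refl
  𝟙-yes (no ¬a) a = contradiction a ¬a

  𝟙-no : ∀ {A : Set} (d : Dec A) → ¬ A → 𝟙 d ≡ 0ℚ
  𝟙-no (yes a) ¬a = contradiction a ¬a
  𝟙-no (no _)  _  = refl

  𝟙-× : ∀ {A B C : Set} (c : Dec C) (a : Dec A) (b : Dec B) →
        (C → A × B) → (A → B → C) → 𝟙 c ≡ 𝟙 a * 𝟙 b
  𝟙-× c (yes a) (yes b) _ f = 𝟙-yes c (f a b)
  𝟙-× c (yes a) (no ¬b) g _ = 𝟙-no c (λ x → ¬b (proj₂ (g x)))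
  𝟙-× c (no ¬a) b       g _ = trans (𝟙-no c (λ x → ¬a (proj₁ (g x)))) (sym (ℚₚ.*-zeroˡ (𝟙 b)))

  -- The witness M is the quotient of N by P, known only through its two defining inequalities. They
  -- suffice for the induction: when P divides N + 1, they force the cofactor to be M + 1.
  ∑ℚ-multiples : ∀ P → 1 ℕ.≤ P → ∀ N (g : ℕ → ℚ) →
    ∃[ M ] (M ℕ.* P ℕ.≤ N × N ℕ.< suc M ℕ.* P ×
      ∑ℚ N (λ i → 𝟙 (P ∣? suc i) * g (suc i)) ≡ ∑ℚ M (λ i → g (suc i ℕ.* P)))
  ∑ℚ-multiples P 1≤P zero    g = 0 , ℕ.z≤n , ℕₚ.≤-trans 1≤P (ℕₚ.m≤m+n P 0) , refl
  ∑ℚ-multiples P 1≤P (suc N) g with ∑ℚ-multiples P 1≤P N g | P ∣? suc N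
  ... | M , lo , hi , e | no P∤ = M , ℕₚ.m≤n⇒m≤1+n lo ,
    ℕₚ.≤∧≢⇒< hi (λ eq → P∤ (divides (suc M) eq)) ,
    trans (cong₂ _+_ e (ℚₚ.*-zeroˡ (g (suc N)))) (ℚₚ.+-identityʳ _)
  ... | M , lo , hi , e | yes (divides c eq) = suc M , ℕₚ.≤-reflexive (sym eq′) ,
    subst (ℕ._< P ℕ.+ suc M ℕ.* P) (sym eq′) (ℕₚ.m<n+m (suc M ℕ.* P) 1≤P) ,
    cong₂ _+_ e (trans (ℚₚ.*-identityˡ (g (suc N))) (cong g eq′))
    where
    instance
      nz : NonZero P
      nz = ℕ.>-nonZero 1≤P
    c≡ : c ≡ suc M
    c≡ = ℕₚ.≤-antisym (ℕₚ.*-cancelʳ-≤ c (suc M) P (subst (ℕ._≤ suc M ℕ.* P) eq hi))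
      (ℕₚ.*-cancelʳ-< P M c (subst (M ℕ.* P ℕ.<_) eq (ℕ.s≤s lo)))
    eq′ : suc N ≡ suc M ℕ.* P
    eq′ = trans eq (cong (ℕ._* P) c≡)

  -- Euler's totient and its quadratic bound.

  -- Euler's totient, defined through ∑_{d ∣ n} φ(d) = n. The first argument of φ′ is fuel.
  φ′ : ℕ → ℕ → ℚ
  φ′ zero    n       = 0ℚ
  φ′ (suc k) zero    = 0ℚ
  φ′ (suc k) (suc n) = ℕ→ℚ (suc n) - ∑ℚ n (λ i → 𝟙 (suc i ∣? suc n) * φ′ k (suc i))

  φ′-fuel : ∀ k l n → n ℕ.≤ k → n ℕ.≤ l → φ′ k n ≡ φ′ l n
  φ′-fuel zero    zero    zero    _ _ = refl
  φ′-fuel zero    (suc l) zero    _ _ = refl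
  φ′-fuel (suc k) zero    zero    _ _ = refl
  φ′-fuel (suc k) (suc l) zero    _ _ = refl
  φ′-fuel (suc k) (suc l) (suc n) (ℕ.s≤s n≤k) (ℕ.s≤s n≤l) = cong (λ t → ℕ→ℚ (suc n) - t)
    (∑ℚ-cong n λ i i<n → cong (𝟙 (suc i ∣? suc n) *_)
      (φ′-fuel k l (suc i) (ℕₚ.≤-trans i<n n≤k) (ℕₚ.≤-trans i<n n≤l)))

  abstract
    φ : ℕ → ℚ
    φ n = φ′ n n

    φ-zero : φ zero ≡ 0ℚ
    φ-zero = refl

    φ-suc : ∀ n → φ (suc n) ≡ ℕ→ℚ (suc n) - ∑ℚ n (λ i → 𝟙 (suc i ∣? suc n) * φ (suc i))
    φ-suc n = cong (λ t → ℕ→ℚ (suc n) - t) (∑ℚ-cong n λ i i<n →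
      cong (𝟙 (suc i ∣? suc n) *_) (φ′-fuel n (suc i) (suc i) i<n ℕₚ.≤-refl))

  -- The recursion for φ(n) subtracts exactly the proper divisors, and indices beyond n contribute
  -- 0. The free upper limit L lets one range of d serve all n at once.
  ∑-divisors-φ : ∀ n L → 1 ℕ.≤ n → n ℕ.≤ L → ∑ℚ L (λ i → 𝟙 (suc i ∣? n) * φ (suc i)) ≡ ℕ→ℚ n
  ∑-divisors-φ (suc n) L _ n<L = trans
    (∑ℚ-truncate _ n<L λ i n<i → trans
      (cong (_* φ (suc i)) (𝟙-no (suc i ∣? suc n) (>⇒∤ (ℕ.s≤s n<i)))) (ℚₚ.*-zeroˡ (φ (suc i))))
    (trans (cong (s +_) (trans (cong (_* φ (suc n)) (𝟙-yes (suc n ∣? suc n) ∣-refl))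
        (trans (ℚₚ.*-identityˡ (φ (suc n))) (φ-suc n))))
      (solve 2 (λ s n → s :+ (n :- s) := n) refl s (ℕ→ℚ (suc n))))
    where
    s = ∑ℚ n (λ i → 𝟙 (suc i ∣? suc n) * φ (suc i))

  sq : ℕ → ℚ
  sq n = ℕ→ℚ (n ℕ.* n)

  -- Write n = a d = c e. Then c < a, and n (e - d) = (a - c) d e ≥ d e ≥ d².
  divisor-gap : ∀ {n d e} → 1 ℕ.≤ n → d ∣ n → e ∣ n → d ℕ.< e → d ℕ.* d ℕ.+ n ℕ.* d ℕ.≤ n ℕ.* e
  divisor-gap {n} {d} {e} 1≤n (divides a p) (divides c q) d<e = begin
      d ℕ.* d ℕ.+ n ℕ.* d         ≡⟨ cong (λ t → d ℕ.* d ℕ.+ t ℕ.* d) q ⟩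
      d ℕ.* d ℕ.+ c ℕ.* e ℕ.* d   ≤⟨ ℕₚ.+-monoˡ-≤ _ (ℕₚ.*-monoˡ-≤ d (ℕₚ.<⇒≤ d<e)) ⟩
      e ℕ.* d ℕ.+ c ℕ.* e ℕ.* d   ≡⟨ cong (e ℕ.* d ℕ.+_) (ℕₚ.*-assoc c e d) ⟩
      suc c ℕ.* (e ℕ.* d)         ≤⟨ ℕₚ.*-monoˡ-≤ (e ℕ.* d) c<a ⟩
      a ℕ.* (e ℕ.* d)             ≡⟨ trans (cong (a ℕ.*_) (ℕₚ.*-comm e d)) (sym (ℕₚ.*-assoc a d e)) ⟩
      a ℕ.* d ℕ.* e               ≡⟨ cong (ℕ._* e) p ⟨
      n ℕ.* e                     ∎
    where
    open ℕₚ.≤-Reasoning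
    c<a : c ℕ.< a
    c<a = ℕₚ.≰⇒> λ a≤c → ℕₚ.<-irrefl (sym p) (begin-strict
      a ℕ.* d ≤⟨ ℕₚ.*-monoˡ-≤ d a≤c ⟩
      c ℕ.* d <⟨ ℕₚ.*-monoʳ-< c {{ℕ.≢-nonZero λ c≡0 → ℕₚ.<⇒≢ 1≤n (sym (trans q (cong (ℕ._* e) c≡0)))}} d<e ⟩
      c ℕ.* e ≡⟨ q ⟨
      n       ∎)

  -- Consecutive divisors d < e of n satisfy d² ≤ n (e − d), so the sum telescopes.
  ∑-divisors-sq : ∀ {n} t m → 1 ℕ.≤ n → m ∣ n → t ℕ.< m →
    ∑ℚ t (λ i → 𝟙 (suc i ∣? n) * sq (suc i)) ≤ ℕ→ℚ n * (ℕ→ℚ m - 1ℚ)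
  ∑-divisors-sq {n} zero    m _ _ 0<m = 0≤* (0≤ℕ→ℚ n) (≤⇒0≤ (ℕ→ℚ-mono 0<m))
  ∑-divisors-sq {n} (suc t) m 1≤n m∣n t<m with suc t ∣? n
  ... | no  _   = ≤-trans (≤-reflexive (trans (cong (s +_) (ℚₚ.*-zeroˡ (sq (suc t)))) (ℚₚ.+-identityʳ s)))
    (∑-divisors-sq t m 1≤n m∣n (ℕₚ.<⇒≤ t<m))
    where
    s = ∑ℚ t (λ i → 𝟙 (suc i ∣? n) * sq (suc i))
  ... | yes d∣n = ≤-trans
    (+-mono-≤ (∑-divisors-sq t (suc t) 1≤n d∣n ℕₚ.≤-refl) (≤-reflexive (ℚₚ.*-identityˡ (sq (suc t)))))
    (0≤⇒≤ (subst (0ℚ ≤_)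
      (solve 4 (λ n d m s → n :* m :- (s :+ n :* d) := n :* (m :- con 1ℚ) :- (n :* (d :- con 1ℚ) :+ s))
        refl (ℕ→ℚ n) (ℕ→ℚ (suc t)) (ℕ→ℚ m) (sq (suc t)))
      (≤⇒0≤ gap)))
    where
    gap : sq (suc t) + ℕ→ℚ n * ℕ→ℚ (suc t) ≤ ℕ→ℚ n * ℕ→ℚ m
    gap = subst₂ _≤_ (trans (ℕ→ℚ-+ (suc t ℕ.* suc t) (n ℕ.* suc t)) (cong (sq (suc t) +_) (ℕ→ℚ-* n (suc t))))
      (ℕ→ℚ-* n m) (ℕ→ℚ-mono (divisor-gap 1≤n d∣n m∣n t<m))

  0≤𝟙 : ∀ {A : Set} (d : Dec A) → 0ℚ ≤ 𝟙 d
  0≤𝟙 (yes _) = <⇒≤ 0<1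
  0≤𝟙 (no _)  = ≤-refl

  -- Strong induction with all signs discarded still closes exactly: the proper divisors contribute
  -- at most n (n - 1), and n + n (n - 1) = n².
  ∣φ∣≤sq : ∀ n → ∣ φ n ∣ ≤ sq n
  ∣φ∣≤sq = <-rec _ λ where
    zero    _   → ≤-reflexive (cong ∣_∣ φ-zero)
    (suc n) rec → subst₂ (λ s t → ∣ s ∣ ≤ t)
      (sym (φ-suc n))
      (trans (solve 1 (λ n → n :+ n :* (n :- con 1ℚ) := n :* n) refl (ℕ→ℚ (suc n)))
        (sym (ℕ→ℚ-* (suc n) (suc n))))
      (∣+∣≤ {ℕ→ℚ (suc n)} (0≤⇒∣∣≤ (0≤ℕ→ℚ (suc n)) ≤-refl)
        (≤-trans (≤-reflexive (ℚₚ.∣-p∣≡∣p∣ (∑ℚ n (λ i → 𝟙 (suc i ∣? suc n) * φ (suc i)))))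
        (≤-trans (∑ℚ-∣∣ n λ i i<n → ∣*∣≤ {𝟙 (suc i ∣? suc n)} {φ (suc i)}
            (0≤⇒∣∣≤ (0≤𝟙 (suc i ∣? suc n)) ≤-refl) (rec (ℕ.s≤s i<n)))
          (∑-divisors-sq n (suc n) (ℕ.s≤s ℕ.z≤n) ∣-refl ℕₚ.≤-refl))))

  -- Reciprocals and tails of zeta series.

  recip-unique : ∀ {p q} → 0ℚ < p → p * q ≡ 1ℚ → recip p ≡ q
  recip-unique {p} {q} 0<p pq≡1 = trans (sym (ℚₚ.*-identityʳ (recip p)))
    (trans (cong (recip p *_) (sym pq≡1))
    (trans (solve 3 (λ r p q → r :* (p :* q) := (p :* r) :* q) refl (recip p) p q)
    (trans (cong (_* q) (recip-inverse 0<p)) (ℚₚ.*-identityˡ q))))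

  recip-* : ∀ {p q} → 0ℚ < p → 0ℚ < q → recip (p * q) ≡ recip p * recip q
  recip-* {p} {q} 0<p 0<q = recip-unique (RationalLemmas.0<* 0<p 0<q)
    (trans (solve 4 (λ p q r s → (p :* q) :* (r :* s) := (p :* r) :* (q :* s)) refl p q (recip p) (recip q))
      (cong₂ _*_ (recip-inverse 0<p) (recip-inverse 0<q)))

  1/ℕ : ℕ → ℚ
  1/ℕ n = recip (ℕ→ℚ n)

  0<1/ℕ : ∀ {n} → 1 ℕ.≤ n → 0ℚ < 1/ℕ n
  0<1/ℕ 1≤n = 0<recip (0<ℕ→ℚ 1≤n)

  1/ℕ-* : ∀ {m n} → 1 ℕ.≤ m → 1 ℕ.≤ n → 1/ℕ (m ℕ.* n) ≡ 1/ℕ m * 1/ℕ n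
  1/ℕ-* {m} {n} 1≤m 1≤n = trans (cong recip (ℕ→ℚ-* m n)) (recip-* (0<ℕ→ℚ 1≤m) (0<ℕ→ℚ 1≤n))

  *1/ℕ≤ : ∀ {m n l} → 1 ℕ.≤ m → 1 ℕ.≤ n → m ℕ.* n ℕ.≤ l → ℕ→ℚ m * 1/ℕ l ≤ 1/ℕ n
  *1/ℕ≤ {m} {n} {l} 1≤m 1≤n mn≤l = ≤-trans
    (*-monoˡ (0≤ℕ→ℚ m) (recip-anti (0<ℕ→ℚ (ℕₚ.*-mono-≤ 1≤m 1≤n)) (ℕ→ℚ-mono mn≤l)))
    (≤-reflexive (trans (cong (ℕ→ℚ m *_) (1/ℕ-* 1≤m 1≤n))
      (trans (sym (ℚₚ.*-assoc (ℕ→ℚ m) (1/ℕ m) (1/ℕ n)))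
      (trans (cong (_* 1/ℕ n) (recip-inverse (0<ℕ→ℚ 1≤m))) (ℚₚ.*-identityˡ (1/ℕ n))))))

  cross-≤ : ∀ {m n p q} → 1 ℕ.≤ n → 1 ℕ.≤ q → m ℕ.* q ℕ.≤ p ℕ.* n → ℕ→ℚ m * 1/ℕ n ≤ ℕ→ℚ p * 1/ℕ q
  cross-≤ {m} {n} {p} {q} 1≤n 1≤q le = subst₂ _≤_
    (eq m q n 1≤q (1/ℕ n)) (trans (cong (ℕ→ℚ p * ℕ→ℚ n *_) (ℚₚ.*-comm (1/ℕ q) (1/ℕ n))) (eq p n q 1≤n (1/ℕ q)))
    (*-monoʳ {1/ℕ q * 1/ℕ n} (0≤* (<⇒≤ (0<1/ℕ 1≤q)) (<⇒≤ (0<1/ℕ 1≤n)))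
      (subst₂ _≤_ (ℕ→ℚ-* m q) (ℕ→ℚ-* p n) (ℕ→ℚ-mono le)))
    where
    eq : ∀ m q n → 1 ℕ.≤ q → ∀ t → (ℕ→ℚ m * ℕ→ℚ q) * (1/ℕ q * t) ≡ ℕ→ℚ m * t
    eq m q n 1≤q t = trans
      (solve 4 (λ m q r t → (m :* q) :* (r :* t) := (q :* r) :* (m :* t)) refl (ℕ→ℚ m) (ℕ→ℚ q) (1/ℕ q) t)
      (trans (cong (_* (ℕ→ℚ m * t)) (recip-inverse (0<ℕ→ℚ 1≤q))) (ℚₚ.*-identityˡ _))

  ζ-mono : ∀ s {m n} → m ℕ.≤ n → ζ-partial s m ≤ ζ-partial s n
  ζ-mono s m≤n = go (ℕₚ.≤⇒≤′ m≤n)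
    where
    go : ∀ {m n} → m ℕ.≤′ n → ζ-partial s m ≤ ζ-partial s n
    go (ℕ.≤′-reflexive refl) = ≤-refl
    go {m} {suc n} (ℕ.≤′-step le) = subst (_≤ ζ-partial s (suc n)) (ℚₚ.+-identityʳ _)
      (+-mono-≤ (go le) (<⇒≤ (0<1/ℕ (ℕₚ.m^n>0 (suc n) s))))

  -- Each term n^-s is at most 1 / (n - 1) - 1 / n, so the tail telescopes to at most 1 / M - 1 / k.
  ζ-tail : ∀ s → 1 ℕ.< s → ∀ M k → 1 ℕ.≤ M → M ℕ.≤ k → ζ-partial s k - ζ-partial s M ≤ 1/ℕ M
  ζ-tail s 1<s M k 1≤M M≤k = ≤-trans (p≤∣p∣ _)
    (≤-trans (telescope (ζ-partial s) 1/ℕ 1ℚ 1 (<⇒≤ 0<1) (ζ-step s 1<s) k M (ℕₚ.≤-trans 1≤M M≤k) 1≤M)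
    (≤-trans (≤-reflexive (trans (ℚₚ.*-identityˡ _) (∣∣-comm (1/ℕ k) (1/ℕ M))))
      (0≤⇒∣∣≤ (≤⇒0≤ (recip-anti (0<ℕ→ℚ 1≤M) (ℕ→ℚ-mono M≤k)))
        (0≤⇒≤ (subst (0ℚ ≤_) (solve 2 (λ a b → b := a :- (a :- b)) refl (1/ℕ M) (1/ℕ k))
          (<⇒≤ (0<1/ℕ (ℕₚ.≤-trans 1≤M M≤k))))))))

  ζ-partial≤2 : ∀ s → 1 ℕ.< s → ∀ k → ζ-partial s k ≤ ℕ→ℚ 2
  ζ-partial≤2 s 1<s zero    = 0≤ℕ→ℚ 2
  ζ-partial≤2 s 1<s (suc k) = subst₂ _≤_
    (solve 2 (λ a b → (a :- b) :+ b := a) refl (ζ-partial s (suc k)) (ζ-partial s 1))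
    refl
    (+-mono-≤ (ζ-tail s 1<s 1 (suc k) ℕₚ.≤-refl (ℕ.s≤s ℕ.z≤n))
      (≤-reflexive {ζ-partial s 1} {1ℚ} (trans (ℚₚ.+-identityˡ _) (cong 1/ℕ (ℕₚ.^-zeroˡ s)))))

  -- The tail is at most 1 / M, and M + 1 ≤ 2M turns k ≤ (M + 1) d into 1 / M ≤ 2d / k. For M = 0
  -- the whole partial sum is at most 2, while k ≤ d makes 2d / k at least 2.
  ζ-tail-multiple : ∀ s → 1 ℕ.< s → ∀ d M k → 1 ℕ.≤ k → M ℕ.≤ k → k ℕ.≤ suc M ℕ.* d →
    ζ-partial s k - ζ-partial s M ≤ ℕ→ℚ (2 ℕ.* d) * 1/ℕ k
  ζ-tail-multiple s 1<s d zero    k 1≤k _   k≤d = ≤-trans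
    (≤-reflexive (ℚₚ.+-identityʳ (ζ-partial s k)))
    (≤-trans (ζ-partial≤2 s 1<s k)
    (≤-trans (≤-reflexive (sym (ℚₚ.*-identityʳ (ℕ→ℚ 2))))
      (cross-≤ {2} {1} {2 ℕ.* d} {k} ℕₚ.≤-refl 1≤k
        (subst (2 ℕ.* k ℕ.≤_) (sym (ℕₚ.*-identityʳ (2 ℕ.* d)))
          (ℕₚ.*-monoʳ-≤ 2 (subst (k ℕ.≤_) (ℕₚ.*-identityˡ d) k≤d))))))
  ζ-tail-multiple s 1<s d (suc M) k 1≤k M≤k k≤ = ≤-trans (ζ-tail s 1<s (suc M) k (ℕ.s≤s ℕ.z≤n) M≤k)
    (≤-trans (≤-reflexive (sym (ℚₚ.*-identityˡ (1/ℕ (suc M)))))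
      (cross-≤ {1} {suc M} {2 ℕ.* d} {k} (ℕ.s≤s ℕ.z≤n) 1≤k (begin
        1 ℕ.* k                    ≡⟨ ℕₚ.*-identityˡ k ⟩
        k                          ≤⟨ k≤ ⟩
        suc (suc M) ℕ.* d          ≤⟨ ℕₚ.*-monoˡ-≤ d (ℕ.s≤s (ℕₚ.m≤n+m (suc M) M)) ⟩
        (suc M ℕ.+ suc M) ℕ.* d    ≡⟨ cong (λ t → (suc M ℕ.+ t) ℕ.* d) (sym (ℕₚ.+-identityʳ (suc M))) ⟩
        2 ℕ.* suc M ℕ.* d          ≡⟨ ℕₚ.*-assoc 2 (suc M) d ⟩
        2 ℕ.* (suc M ℕ.* d)        ≡⟨ cong (2 ℕ.*_) (ℕₚ.*-comm (suc M) d) ⟩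
        2 ℕ.* (d ℕ.* suc M)        ≡⟨ sym (ℕₚ.*-assoc 2 d (suc M)) ⟩
        2 ℕ.* d ℕ.* suc M          ∎)))
    where open ℕₚ.≤-Reasoning

  ∑ℚ-∣-∣ : ∀ n {f g c} → (∀ i → i ℕ.< n → ∣ f i - g i ∣ ≤ c i) → ∣ ∑ℚ n f - ∑ℚ n g ∣ ≤ ∑ℚ n c
  ∑ℚ-∣-∣ n {f} {g} {c} h = subst (λ t → ∣ t ∣ ≤ ∑ℚ n c) difference (∑ℚ-∣∣ n h)
    where
    difference : ∑ℚ n (λ i → f i - g i) ≡ ∑ℚ n f - ∑ℚ n g
    difference = trans (∑ℚ-+ n f (λ i → - g i)) (cong (∑ℚ n f +_)
      (trans (∑ℚ-cong n λ i _ → solve 1 (λ x → :- x := (:- con 1ℚ) :* x) refl (g i))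
      (trans (∑ℚ-*ˡ n (- 1ℚ) g) (solve 1 (λ x → (:- con 1ℚ) :* x := :- x) refl (∑ℚ n g)))))

  -- The Dirichlet series of φ and its value ζ(s - 1) / ζ(s).

  Φ : ℕ → ℕ → ℚ
  Φ s k = ∑ℚ k (λ i → φ (suc i) * 1/ℕ (suc i ℕ.^ s))

  -- Expand m^-t = m · m^-(t+1) by m = ∑ φ(d) over d ∣ m, then exchange the sums. For the infinite
  -- series this would already be the Euler product identity; here the inner sum still runs over
  -- multiples up to k.
  ζ-partial-shift : ∀ t k → ζ-partial t k ≡
    ∑ℚ k (λ d → φ (suc d) * ∑ℚ k (λ m → 𝟙 (suc d ∣? suc m) * 1/ℕ (suc m ℕ.^ suc t)))
  ζ-partial-shift t k = trans (∑ℚ-cong k term)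
    (trans (∑ℚ-swap k k λ m d → φ (suc d) * (𝟙 (suc d ∣? suc m) * g m))
      (∑ℚ-cong k λ d _ → ∑ℚ-*ˡ k (φ (suc d)) λ m → 𝟙 (suc d ∣? suc m) * g m))
    where
    g : ℕ → ℚ
    g m = 1/ℕ (suc m ℕ.^ suc t)
    term : ∀ m → m ℕ.< k → 1/ℕ (suc m ℕ.^ t) ≡ ∑ℚ k (λ d → φ (suc d) * (𝟙 (suc d ∣? suc m) * g m))
    term m m<k = sym (trans
      (∑ℚ-cong k λ d _ → solve 3 (λ p i g → p :* (i :* g) := g :* (i :* p)) refl
        (φ (suc d)) (𝟙 (suc d ∣? suc m)) (g m))
      (trans (∑ℚ-*ˡ k (g m) λ d → 𝟙 (suc d ∣? suc m) * φ (suc d))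
      (trans (cong (g m *_) (∑-divisors-φ (suc m) k (ℕ.s≤s ℕ.z≤n) m<k))
      (trans (cong (_* ℕ→ℚ (suc m)) (1/ℕ-* {suc m} (ℕ.s≤s ℕ.z≤n) (ℕₚ.m^n>0 (suc m) t)))
      (trans (solve 3 (λ r x n → (r :* x) :* n := (n :* r) :* x) refl
               (1/ℕ (suc m)) (1/ℕ (suc m ℕ.^ t)) (ℕ→ℚ (suc m)))
      (trans (cong (_* 1/ℕ (suc m ℕ.^ t)) (recip-inverse (0<ℕ→ℚ {suc m} (ℕ.s≤s ℕ.z≤n))))
        (ℚₚ.*-identityˡ _)))))))

  1≤d^ : ∀ d s → 1 ℕ.≤ suc d ℕ.^ s
  1≤d^ d s = ℕₚ.m^n>0 (suc d) s

  -- The contribution of one d to the truncation discrepancy: d² bounds |φ(d)|, and 2d times r = 1 /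
  -- k bounds the missing tail. With s ≥ 5 a factor d^-2 remains, which is summable.
  weight≤ : ∀ {n s r} → 1 ℕ.≤ n → 5 ℕ.≤ s → 0ℚ ≤ r →
    sq n * (1/ℕ (n ℕ.^ s) * (ℕ→ℚ (2 ℕ.* n) * r)) ≤ (ℕ→ℚ 2 * r) * 1/ℕ (n ℕ.^ 2)
  weight≤ {n} {s} {r} 1≤n 5≤s 0≤r = ≤-trans (≤-reflexive regroup)
    (*-monoˡ (0≤* (0≤ℕ→ℚ 2) 0≤r)
      (*1/ℕ≤ {n ℕ.* n ℕ.* n} {n ℕ.^ 2} (ℕₚ.*-mono-≤ (ℕₚ.*-mono-≤ 1≤n 1≤n) 1≤n) (ℕₚ.m^n>0 n 2) power≤))
    where
    instance
      nz : NonZero n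
      nz = ℕ.>-nonZero 1≤n
    regroup : sq n * (1/ℕ (n ℕ.^ s) * (ℕ→ℚ (2 ℕ.* n) * r)) ≡
              (ℕ→ℚ 2 * r) * (ℕ→ℚ (n ℕ.* n ℕ.* n) * 1/ℕ (n ℕ.^ s))
    regroup = trans (cong (λ y → sq n * (1/ℕ (n ℕ.^ s) * (y * r))) (ℕ→ℚ-* 2 n))
      (trans (solve 5 (λ q x two n i → q :* (x :* ((two :* n) :* i)) := (two :* i) :* ((q :* n) :* x)) refl
               (sq n) (1/ℕ (n ℕ.^ s)) (ℕ→ℚ 2) (ℕ→ℚ n) r)
        (cong (λ x → (ℕ→ℚ 2 * r) * (x * 1/ℕ (n ℕ.^ s))) (sym (ℕ→ℚ-* (n ℕ.* n) n))))
    power≤ : n ℕ.* n ℕ.* n ℕ.* n ℕ.^ 2 ℕ.≤ n ℕ.^ s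
    power≤ = ℕₚ.≤-trans (ℕₚ.≤-reflexive (trans
        (cong (ℕ._* n ℕ.^ 2) (trans (ℕₚ.*-assoc n n n)
          (cong (λ t → n ℕ.* (n ℕ.* t)) (sym (ℕₚ.*-identityʳ n)))))
        (sym (ℕₚ.^-distribˡ-+-* n 3 2))))
      (ℕₚ.^-monoʳ-≤ n 5≤s)

  ∑-multiples-power : ∀ s d k → 1 ℕ.≤ d → ∃[ M ] (M ℕ.≤ k × k ℕ.≤ suc M ℕ.* d ×
    ∑ℚ k (λ m → 𝟙 (d ∣? suc m) * 1/ℕ (suc m ℕ.^ s)) ≡ 1/ℕ (d ℕ.^ s) * ζ-partial s M)
  ∑-multiples-power s d k 1≤d =
    let M , lo , hi , e = ∑ℚ-multiples d 1≤d k (λ m → 1/ℕ (m ℕ.^ s)) in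
    M , ℕₚ.≤-trans (ℕₚ.m≤m*n M d {{ℕ.>-nonZero 1≤d}}) lo , ℕₚ.<⇒≤ hi ,
      trans e (trans (∑ℚ-cong M λ i _ → power i) (∑ℚ-*ˡ M (1/ℕ (d ℕ.^ s)) λ i → 1/ℕ (suc i ℕ.^ s)))
    where
    power : ∀ i → 1/ℕ ((suc i ℕ.* d) ℕ.^ s) ≡ 1/ℕ (d ℕ.^ s) * 1/ℕ (suc i ℕ.^ s)
    power i = trans (cong 1/ℕ (^-distribʳ-* s (suc i) d))
      (trans (1/ℕ-* (ℕₚ.m^n>0 (suc i) s) (ℕₚ.m^n>0 d {{ℕ.>-nonZero 1≤d}} s))
        (ℚₚ.*-comm (1/ℕ (suc i ℕ.^ s)) (1/ℕ (d ℕ.^ s))))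

  weighted-gap : ∀ {p q r z z′ S B C} → ∣ p ∣ ≤ q → 0ℚ ≤ r → ∣ z - z′ ∣ ≤ B → S ≡ r * z′ →
    q * (r * B) ≤ C → ∣ z * (p * r) - p * S ∣ ≤ C
  weighted-gap {p} {q} {r} {z} {z′} p≤q 0≤r gap refl le = ≤-trans
    (≤-reflexive (cong ∣_∣
      (solve 4 (λ z z′ p r → z :* (p :* r) :- p :* (r :* z′) := p :* (r :* (z :- z′))) refl z z′ p r)))
    (≤-trans (∣*∣≤ {p} p≤q (∣*∣≤ {r} (0≤⇒∣∣≤ 0≤r ≤-refl) gap)) le)

  -- Both quantities are sums over d of φ(d) d^-s, for s = t + 1, times a partial zeta sum: of
  -- length k in the product, but of length M, the quotient of k by d, in `ζ-partial t k`. The gap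
  -- is at most 2d / k, and the weighted gaps add up to at most (2 / k) · 2.
  Φ*ζ≈ζ : ∀ t → 4 ℕ.≤ t → ∀ k → 1 ℕ.≤ k →
    ∣ Φ (suc t) k * ζ-partial (suc t) k - ζ-partial t k ∣ ≤ ℕ→ℚ 4 * 1/ℕ k
  Φ*ζ≈ζ t 4≤t k 1≤k = ≤-trans (≤-reflexive (cong ∣_∣ (cong₂ _-_ product (ζ-partial-shift t k))))
    (≤-trans (∑ℚ-∣-∣ k term)
    (≤-trans (≤-reflexive (∑ℚ-*ˡ k (ℕ→ℚ 2 * 1/ℕ k) (λ d → 1/ℕ (suc d ℕ.^ 2))))
    (≤-trans (*-monoˡ (0≤* (0≤ℕ→ℚ 2) (<⇒≤ (0<1/ℕ 1≤k))) (ζ-partial≤2 2 ℕₚ.≤-refl k))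
      (≤-reflexive (solve 1 (λ r → (con (ℕ→ℚ 2) :* r) :* con (ℕ→ℚ 2) := con (ℕ→ℚ 4) :* r) refl (1/ℕ k))))))
    where
    s = suc t
    Z = ζ-partial s k
    R : ℕ → ℚ
    R d = 1/ℕ (suc d ℕ.^ s)
    S : ℕ → ℚ
    S d = ∑ℚ k (λ m → 𝟙 (suc d ∣? suc m) * 1/ℕ (suc m ℕ.^ s))
    product : Φ s k * Z ≡ ∑ℚ k (λ d → Z * (φ (suc d) * R d))
    product = trans (ℚₚ.*-comm (Φ s k) Z) (sym (∑ℚ-*ˡ k Z (λ d → φ (suc d) * R d)))
    tail : ∀ d → ∃[ M ] (∣ Z - ζ-partial s M ∣ ≤ ℕ→ℚ (2 ℕ.* suc d) * 1/ℕ k × S d ≡ R d * ζ-partial s M)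
    tail d = let M , M≤k , k≤ , e = ∑-multiples-power s (suc d) k (ℕ.s≤s ℕ.z≤n) in
      M , 0≤⇒∣∣≤ (≤⇒0≤ (ζ-mono s M≤k))
        (ζ-tail-multiple s (ℕ.s≤s (ℕₚ.≤-trans (ℕ.s≤s ℕ.z≤n) 4≤t)) (suc d) M k 1≤k M≤k k≤) , e
    term : ∀ d → d ℕ.< k → ∣ Z * (φ (suc d) * R d) - φ (suc d) * S d ∣ ≤ (ℕ→ℚ 2 * 1/ℕ k) * 1/ℕ (suc d ℕ.^ 2)
    term d _ = let M , tail≤ , e = tail d in
      weighted-gap {φ (suc d)} {sq (suc d)} {R d} {Z} {ζ-partial s M} (∣φ∣≤sq (suc d)) (<⇒≤ (0<1/ℕ (1≤d^ d s))) tail≤ e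
        (weight≤ {suc d} {s} {1/ℕ k} (ℕ.s≤s ℕ.z≤n) (ℕ.s≤s 4≤t) (<⇒≤ (0<1/ℕ 1≤k)))

  -- The previous estimate divided by a partial zeta sum, which is at least 1 and so does not
  -- enlarge the error; the outer 6 cancels the one in the denominator.
  constant≈Φ : ∀ t → 4 ℕ.≤ t → ∀ k → 1 ℕ.≤ k →
    ∣ ℕ→ℚ 6 * (ζ-partial t k * recip (ℕ→ℚ 6 * ζ-partial (suc t) k)) - Φ (suc t) k ∣ ≤ ℕ→ℚ 4 * 1/ℕ k
  constant≈Φ t 4≤t k 1≤k = ≤-trans (≤-reflexive (trans (cong ∣_∣ difference) (∣∣-comm′)))
    (≤-trans (∣*∣≤ {Φ (suc t) k * Z - Z′} {recip Z} (Φ*ζ≈ζ t 4≤t k 1≤k)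
        (0≤⇒∣∣≤ (<⇒≤ (0<recip 0<Z)) (recip-anti 0<1 1≤Z)))
      (≤-reflexive (ℚₚ.*-identityʳ _)))
    where
    Z = ζ-partial (suc t) k
    Z′ = ζ-partial t k
    1≤Z = 1≤ζ-partial (suc t) k 1≤k
    0<Z = <-≤-trans 0<1 1≤Z
    0<6 = 0<ℕ→ℚ {6} (ℕ.s≤s ℕ.z≤n)
    ∣∣-comm′ : ∣ - ((Φ (suc t) k * Z - Z′) * recip Z) ∣ ≡ ∣ (Φ (suc t) k * Z - Z′) * recip Z ∣
    ∣∣-comm′ = ℚₚ.∣-p∣≡∣p∣ ((Φ (suc t) k * Z - Z′) * recip Z)
    difference : ℕ→ℚ 6 * (Z′ * recip (ℕ→ℚ 6 * Z)) - Φ (suc t) k ≡ - ((Φ (suc t) k * Z - Z′) * recip Z)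
    difference = trans (cong (λ x → ℕ→ℚ 6 * (Z′ * x) - Φ (suc t) k) (recip-* 0<6 0<Z))
      (trans (solve 5 (λ n z r i f → n :* (z :* (r :* i)) :- f := (n :* r) :* (z :* i) :- f :* con 1ℚ) refl
        (ℕ→ℚ 6) Z′ (1/ℕ 6) (recip Z) (Φ (suc t) k))
      (trans (cong₂ (λ x y → x * (Z′ * recip Z) - Φ (suc t) k * y) (recip-inverse 0<6) (sym (recip-inverse 0<Z)))
        (solve 4 (λ z z′ i f → con 1ℚ :* (z′ :* i) :- f :* (z :* i) := :- ((f :* z :- z′) :* i)) refl
          Z Z′ (recip Z) (Φ (suc t) k))))

  -- The inner sum of m (1 - m z) compared with y² / 6.

  kernel-sum : ∀ M z → ℕ→ℚ 6 * ∑ℚ M (λ i → (1ℚ - ℕ→ℚ (suc i) * z) * ℕ→ℚ (suc i)) ≡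
    ℕ→ℚ 3 * (ℕ→ℚ M * (ℕ→ℚ M + 1ℚ)) - ℕ→ℚ M * (ℕ→ℚ M + 1ℚ) * (ℕ→ℚ 2 * ℕ→ℚ M + 1ℚ) * z
  kernel-sum zero    z = solve 1 (λ z → con (ℕ→ℚ 6) :* con 0ℚ :=
    con (ℕ→ℚ 3) :* (con 0ℚ :* (con 0ℚ :+ con 1ℚ))
      :- con 0ℚ :* (con 0ℚ :+ con 1ℚ) :* (con (ℕ→ℚ 2) :* con 0ℚ :+ con 1ℚ) :* z) refl z
  kernel-sum (suc M) z = trans
    (ℚₚ.*-distribˡ-+ (ℕ→ℚ 6) (∑ℚ M (λ i → (1ℚ - ℕ→ℚ (suc i) * z) * ℕ→ℚ (suc i))) ((1ℚ - ℕ→ℚ (suc M) * z) * ℕ→ℚ (suc M)))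
    (trans (cong (_+ ℕ→ℚ 6 * ((1ℚ - ℕ→ℚ (suc M) * z) * ℕ→ℚ (suc M))) (kernel-sum M z))
      (step (ℕ→ℚ M) (ℕ→ℚ (suc M)) (ℕ→ℚ-+ 1 M)))
    where
    step : ∀ m m′ → m′ ≡ 1ℚ + m →
      (ℕ→ℚ 3 * (m * (m + 1ℚ)) - m * (m + 1ℚ) * (ℕ→ℚ 2 * m + 1ℚ) * z) + ℕ→ℚ 6 * ((1ℚ - m′ * z) * m′) ≡
      ℕ→ℚ 3 * (m′ * (m′ + 1ℚ)) - m′ * (m′ + 1ℚ) * (ℕ→ℚ 2 * m′ + 1ℚ) * z
    step m _ refl = solve 2 (λ m z →
        (con (ℕ→ℚ 3) :* (m :* (m :+ con 1ℚ)) :- m :* (m :+ con 1ℚ) :* (con (ℕ→ℚ 2) :* m :+ con 1ℚ) :* z)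
          :+ con (ℕ→ℚ 6) :* ((con 1ℚ :- (con 1ℚ :+ m) :* z) :* (con 1ℚ :+ m)) :=
        con (ℕ→ℚ 3) :* ((con 1ℚ :+ m) :* ((con 1ℚ :+ m) :+ con 1ℚ))
          :- (con 1ℚ :+ m) :* ((con 1ℚ :+ m) :+ con 1ℚ) :* (con (ℕ→ℚ 2) :* (con 1ℚ :+ m) :+ con 1ℚ) :* z)
      refl m z

  -- With y z = 1 and u = m − y, the closed form minus y² is −z (u² (2m + y) + 3mu + m).
  kernel-bound : ∀ {m y z} → y * z ≡ 1ℚ → 0ℚ ≤ y → 0ℚ ≤ z → 1ℚ ≤ m → m ≤ y + 1ℚ → y ≤ m + 1ℚ → m ≤ y + y →
    ∣ (ℕ→ℚ 3 * (m * (m + 1ℚ)) - m * (m + 1ℚ) * (ℕ→ℚ 2 * m + 1ℚ) * z) - y * y ∣ ≤ ℕ→ℚ 26 * y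
  kernel-bound {m} {y} {z} yz≡1 0≤y 0≤z 1≤m m≤y+1 y≤m+1 m≤2y = ≤-trans
    (≤-reflexive (trans (cong ∣_∣ factored) (ℚₚ.∣-p∣≡∣p∣ (z * W))))
    (≤-trans (∣*∣≤ {z} {W} (0≤⇒∣∣≤ 0≤z ≤-refl) ∣W∣≤)
    (≤-trans (≤-reflexive zW≡)
      -- 13 ≤ 26 y, because 1 ≤ m ≤ 2y.
      (0≤⇒≤ (subst (0ℚ ≤_)
        (solve 2 (λ m y → con (ℕ→ℚ 13) :* ((y :+ y) :- m) :+ con (ℕ→ℚ 13) :* (m :- con 1ℚ)
          := con (ℕ→ℚ 26) :* y :- con (ℕ→ℚ 13)) refl m y)
        (0≤+ (0≤* (0≤ℕ→ℚ 13) (≤⇒0≤ m≤2y)) (0≤* (0≤ℕ→ℚ 13) (≤⇒0≤ 1≤m)))))))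
    where
    u = m - y
    W = u * (u * (m + m + y)) + ℕ→ℚ 3 * m * u + m
    0≤m = ≤-trans (<⇒≤ 0<1) 1≤m
    zW≡ : z * (ℕ→ℚ 13 * y) ≡ ℕ→ℚ 13
    zW≡ = trans (solve 3 (λ z y c → z :* (c :* y) := c :* (y :* z)) refl z y (ℕ→ℚ 13))
      (trans (cong (ℕ→ℚ 13 *_) yz≡1) (ℚₚ.*-identityʳ (ℕ→ℚ 13)))
    ∣u∣≤1 : ∣ u ∣ ≤ 1ℚ
    ∣u∣≤1 = ∣∣≤ {u}
      (0≤⇒≤ (subst (0ℚ ≤_) (solve 2 (λ m y → (y :+ con 1ℚ) :- m := con 1ℚ :- (m :- y)) refl m y) (≤⇒0≤ m≤y+1)))
      (0≤⇒≤ (subst (0ℚ ≤_) (solve 2 (λ m y → (m :+ con 1ℚ) :- y := con 1ℚ :- (:- (m :- y))) refl m y) (≤⇒0≤ y≤m+1)))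
    ∣W∣≤ : ∣ W ∣ ≤ ℕ→ℚ 13 * y
    -- With |u| ≤ 1 the three parts of `W` total at most (2m + y) + 3m + m = 6m + y, and m ≤ 2y
    -- gives 13 y.
    ∣W∣≤ = ≤-trans
      (∣+∣≤ {u * (u * (m + m + y)) + ℕ→ℚ 3 * m * u} {m}
        (∣+∣≤ {u * (u * (m + m + y))} {ℕ→ℚ 3 * m * u}
          (∣*∣≤ {u} ∣u∣≤1 (∣*∣≤ {u} ∣u∣≤1 (0≤⇒∣∣≤ (0≤+ (0≤+ 0≤m 0≤m) 0≤y) ≤-refl)))
          (∣*∣≤ {ℕ→ℚ 3 * m} {u} (0≤⇒∣∣≤ (0≤* (0≤ℕ→ℚ 3) 0≤m) ≤-refl) ∣u∣≤1))
        (0≤⇒∣∣≤ 0≤m ≤-refl))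
      (0≤⇒≤ (subst (0ℚ ≤_)
        (solve 2 (λ m y → con (ℕ→ℚ 6) :* ((y :+ y) :- m) := con (ℕ→ℚ 13) :* y :-
          (con 1ℚ :* (con 1ℚ :* (m :+ m :+ y)) :+ con (ℕ→ℚ 3) :* m :* con 1ℚ :+ m)) refl m y)
        (0≤* (0≤ℕ→ℚ 6) (≤⇒0≤ m≤2y))))
    factored : (ℕ→ℚ 3 * (m * (m + 1ℚ)) - m * (m + 1ℚ) * (ℕ→ℚ 2 * m + 1ℚ) * z) - y * y ≡ - (z * W)
    factored = trans
      (solve 3 (λ m y z → (con (ℕ→ℚ 3) :* (m :* (m :+ con 1ℚ)) :- m :* (m :+ con 1ℚ) :* (con (ℕ→ℚ 2) :* m :+ con 1ℚ) :* z) :- y :* y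
        := (con (ℕ→ℚ 3) :* (m :* (m :+ con 1ℚ)) :- y :* y) :* con 1ℚ :- m :* (m :+ con 1ℚ) :* (con (ℕ→ℚ 2) :* m :+ con 1ℚ) :* z)
        refl m y z)
      (trans (cong (λ t → (ℕ→ℚ 3 * (m * (m + 1ℚ)) - y * y) * t - m * (m + 1ℚ) * (ℕ→ℚ 2 * m + 1ℚ) * z) (sym yz≡1))
        (solve 3 (λ m y z → (con (ℕ→ℚ 3) :* (m :* (m :+ con 1ℚ)) :- y :* y) :* (y :* z) :- m :* (m :+ con 1ℚ) :* (con (ℕ→ℚ 2) :* m :+ con 1ℚ) :* z
          := :- (z :* ((m :- y) :* ((m :- y) :* (m :+ m :+ y)) :+ con (ℕ→ℚ 3) :* m :* (m :- y) :+ m)))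
          refl m y z))

  -- For M = 0 the sum is empty and y ≤ 1, so y² is itself within the error. This case covers every
  -- d whose power d ^ b exceeds N, so the main term can be summed over d without a cutoff depending
  -- on x.
  kernel-error : ∀ M {y z} → y * z ≡ 1ℚ → 0ℚ ≤ y → 0ℚ ≤ z →
    ℕ→ℚ M ≤ y + 1ℚ → y ≤ ℕ→ℚ M + 1ℚ → ℕ→ℚ M ≤ y + y →
    ∣ ℕ→ℚ 6 * ∑ℚ M (λ i → (1ℚ - ℕ→ℚ (suc i) * z) * ℕ→ℚ (suc i)) - y * y ∣ ≤ ℕ→ℚ 26 * y
  kernel-error zero {y} _ 0≤y _ _ y≤1 _ = ≤-trans
    (≤-reflexive (trans (cong ∣_∣ (solve 1 (λ y → con (ℕ→ℚ 6) :* con 0ℚ :- y :* y := :- (y :* y)) refl y))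
      (ℚₚ.∣-p∣≡∣p∣ (y * y))))
    (0≤⇒∣∣≤ (0≤* 0≤y 0≤y) (*-monoʳ 0≤y (≤-trans y≤1 (ℕ→ℚ-mono {1} {26} (ℕ.s≤s ℕ.z≤n)))))
  kernel-error (suc M) {y} {z} yz≡1 0≤y 0≤z p q r = ≤-trans
    (≤-reflexive (cong (λ t → ∣ t - y * y ∣) (kernel-sum (suc M) z)))
    (kernel-bound {ℕ→ℚ (suc M)} yz≡1 0≤y 0≤z (ℕ→ℚ-mono {1} {suc M} (ℕ.s≤s ℕ.z≤n)) p q r)

  -- Substituting n = m P turns the slice into the kernel sum with y = q / P and z = P / q; dividing
  -- by P ≥ 1 preserves the tolerance of 1.
  slice-error : ∀ P → 1 ℕ.≤ P → ∀ N {q} → 1ℚ ≤ q → ℕ→ℚ N ≤ q + 1ℚ → q ≤ ℕ→ℚ N + 1ℚ →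
    ∣ ℕ→ℚ 6 * ∑ℚ N (λ i → 𝟙 (P ∣? suc i) * ((1ℚ - ℕ→ℚ (suc i) * recip q) * (ℕ→ℚ (suc i) * 1/ℕ P)))
      - (q * 1/ℕ P) * (q * 1/ℕ P) ∣ ≤ ℕ→ℚ 26 * (q * 1/ℕ P)
  slice-error P 1≤P N {q} 1≤q N≤ ≤N with
    ∑ℚ-multiples P 1≤P N (λ n → (1ℚ - ℕ→ℚ n * recip q) * (ℕ→ℚ n * 1/ℕ P))
  ... | M , lo , hi , e = ≤-trans
      (≤-reflexive (cong (λ t → ∣ ℕ→ℚ 6 * t - (q * r) * (q * r) ∣)
        (trans e (∑ℚ-cong M λ i _ → term (suc i)))))
      (kernel-error M yz≡1 (0≤* 0≤q 0≤r) (0≤* (0≤ℕ→ℚ P) (<⇒≤ (0<recip 0<q)))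
        (≤-trans M≤ (0≤⇒≤ (subst (0ℚ ≤_) (solve 2 (λ q r → con 1ℚ :- r := (q :* r :+ con 1ℚ) :- (q :+ con 1ℚ) :* r) refl q r)
          (≤⇒0≤ r≤1))))
        y≤M+1
        (≤-trans M≤ (≤-trans (*-monoʳ 0≤r (ℚₚ.+-monoʳ-≤ q 1≤q)) (≤-reflexive (ℚₚ.*-distribʳ-+ r q q)))))
    where
    r = 1/ℕ P
    p = ℕ→ℚ P
    0<q = <-≤-trans 0<1 1≤q
    0≤q = <⇒≤ 0<q
    0≤r = <⇒≤ (0<1/ℕ 1≤P)
    pr≡1 : p * r ≡ 1ℚ
    pr≡1 = recip-inverse (0<ℕ→ℚ 1≤P)
    r≤1 : r ≤ 1ℚ
    r≤1 = recip-anti {1ℚ} 0<1 (ℕ→ℚ-mono {1} 1≤P)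
    cancel : ∀ x → (x * p) * r ≡ x
    cancel x = trans (ℚₚ.*-assoc x p r) (trans (cong (x *_) pr≡1) (ℚₚ.*-identityʳ x))
    yz≡1 : (q * r) * (p * recip q) ≡ 1ℚ
    yz≡1 = trans (solve 4 (λ q r p s → (q :* r) :* (p :* s) := (q :* s) :* (p :* r)) refl q r p (recip q))
      (cong₂ _*_ (recip-inverse 0<q) pr≡1)
    term : ∀ m → (1ℚ - ℕ→ℚ (m ℕ.* P) * recip q) * (ℕ→ℚ (m ℕ.* P) * r) ≡ (1ℚ - ℕ→ℚ m * (p * recip q)) * ℕ→ℚ m
    term m = trans (cong (λ t → (1ℚ - t * recip q) * (t * r)) (ℕ→ℚ-* m P))
      (cong₂ (λ s t → (1ℚ - s) * t) (ℚₚ.*-assoc (ℕ→ℚ m) p (recip q)) (cancel (ℕ→ℚ m)))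
    -- Used twice: r ≤ 1 bounds the right side by y + 1, and 1 ≤ q bounds it by 2y.
    M≤ : ℕ→ℚ M ≤ (q + 1ℚ) * r
    M≤ = subst (_≤ (q + 1ℚ) * r) (trans (cong (_* r) (ℕ→ℚ-* M P)) (cancel (ℕ→ℚ M)))
      (*-monoʳ 0≤r (≤-trans (ℕ→ℚ-mono lo) N≤))
    y≤M+1 : q * r ≤ ℕ→ℚ M + 1ℚ
    y≤M+1 = subst (q * r ≤_)
      (trans (cong (_* r) (ℕ→ℚ-* (suc M) P)) (trans (cancel (ℕ→ℚ (suc M)))
        (trans (ℕ→ℚ-+ 1 M) (ℚₚ.+-comm 1ℚ (ℕ→ℚ M)))))
      (*-monoʳ 0≤r (≤-trans ≤N (subst (_≤ ℕ→ℚ (suc M ℕ.* P))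
        (trans (ℕ→ℚ-+ 1 N) (ℚₚ.+-comm 1ℚ (ℕ→ℚ N))) (ℕ→ℚ-mono hi))))

  -- Expansion of `h` over common power divisors.

  gcd[]-expand : ∀ b′ j n L → suc j ℕ.≤ L → ℕ→ℚ (gcd[ suc b′ ] (suc j) n) ≡
    ∑ℚ L (λ d → 𝟙 (suc d ℕ.^ suc b′ ∣? suc j) * (𝟙 (suc d ℕ.^ suc b′ ∣? n) * φ (suc d)))
  gcd[]-expand b′ j n L j<L = trans
    (sym (∑-divisors-φ G L (1≤gcd[] b′ j n) (ℕₚ.≤-trans (gcd[]≤ b′ j n) j<L)))
    (∑ℚ-cong L λ d _ → trans
      (cong (_* φ (suc d)) (𝟙-× (suc d ∣? G) (suc d ℕ.^ b ∣? suc j) (suc d ℕ.^ b ∣? n)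
        (∣gcd[]⇒common b′ j n) (common∣gcd[] b′ j n)))
      (ℚₚ.*-assoc (𝟙 (suc d ℕ.^ b ∣? suc j)) (𝟙 (suc d ℕ.^ b ∣? n)) (φ (suc d))))
    where
    b = suc b′
    G = gcd[ b ] (suc j) n

  -- The indicator restricts to P ∣ n, where the number of multiples of P up to n is exactly n / P,
  -- with no rounding error.
  count-multiples : ∀ P → 1 ℕ.≤ P → ∀ n →
    𝟙 (P ∣? n) * ∑ℚ n (λ j → 𝟙 (P ∣? suc j)) ≡ 𝟙 (P ∣? n) * (ℕ→ℚ n * 1/ℕ P)
  count-multiples P 1≤P n with P ∣? n
  ... | no  _ = trans (ℚₚ.*-zeroˡ (∑ℚ n (λ j → 𝟙 (P ∣? suc j)))) (sym (ℚₚ.*-zeroˡ (ℕ→ℚ n * 1/ℕ P)))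
  ... | yes (divides c n≡cP) with ∑ℚ-multiples P 1≤P n (λ _ → 1ℚ)
  ... | M , lo , hi , e = cong (1ℚ *_) (trans
      (∑ℚ-cong n λ j _ → sym (ℚₚ.*-identityʳ (𝟙 (P ∣? suc j))))
      (trans e (trans (∑ℚ-const M 1ℚ) (trans (ℚₚ.*-identityʳ (ℕ→ℚ M)) (sym quotient≡)))))
    where
    instance
      nz : NonZero P
      nz = ℕ.>-nonZero 1≤P
    c≡M : c ≡ M
    c≡M = ℕₚ.≤-antisym
      (ℕₚ.≤-pred (ℕₚ.*-cancelʳ-< P c (suc M) (subst (ℕ._< suc M ℕ.* P) n≡cP hi)))
      (ℕₚ.*-cancelʳ-≤ M c P (subst (M ℕ.* P ℕ.≤_) n≡cP lo))
    quotient≡ : ℕ→ℚ n * 1/ℕ P ≡ ℕ→ℚ M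
    quotient≡ = trans (cong (λ t → ℕ→ℚ t * 1/ℕ P) (trans n≡cP (cong (ℕ._* P) c≡M)))
      (trans (cong (_* 1/ℕ P) (ℕ→ℚ-* M P)) (trans (ℚₚ.*-assoc (ℕ→ℚ M) (ℕ→ℚ P) (1/ℕ P))
        (trans (cong (ℕ→ℚ M *_) (recip-inverse (0<ℕ→ℚ 1≤P))) (ℚₚ.*-identityʳ (ℕ→ℚ M)))))

  h-expand : ∀ b′ n L → n ℕ.≤ L → ℕ→ℚ (h (suc b′) n) ≡
    ∑ℚ L (λ d → φ (suc d) * (𝟙 (suc d ℕ.^ suc b′ ∣? n) * (ℕ→ℚ n * 1/ℕ (suc d ℕ.^ suc b′))))
  h-expand b′ n L n≤L = trans (∑ℚ-list-sum n (λ j → gcd[ b ] j n))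
    (trans (∑ℚ-cong n λ j j<n → gcd[]-expand b′ j n L (ℕₚ.≤-trans j<n n≤L))
    (trans (∑ℚ-swap n L λ j d → 𝟙 (suc d ℕ.^ b ∣? suc j) * (𝟙 (suc d ℕ.^ b ∣? n) * φ (suc d)))
      (∑ℚ-cong L λ d _ → column (suc d ℕ.^ b) (ℕₚ.m^n>0 (suc d) b) (φ (suc d)))))
    where
    b = suc b′
    column : ∀ P → 1 ℕ.≤ P → ∀ c → ∑ℚ n (λ j → 𝟙 (P ∣? suc j) * (𝟙 (P ∣? n) * c)) ≡
             c * (𝟙 (P ∣? n) * (ℕ→ℚ n * 1/ℕ P))
    column P 1≤P c = trans
      (∑ℚ-cong n λ j _ → solve 3 (λ i k c → i :* (k :* c) := (c :* k) :* i) refl (𝟙 (P ∣? suc j)) (𝟙 (P ∣? n)) c)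
      (trans (∑ℚ-*ˡ n (c * 𝟙 (P ∣? n)) (λ j → 𝟙 (P ∣? suc j)))
      (trans (ℚₚ.*-assoc c (𝟙 (P ∣? n)) _) (cong (c *_) (count-multiples P 1≤P n))))

  -- Exact for every L ≥ N, since d > N leaves the inner sum zero. Later L is the index k at which
  -- the zeta series are cut.
  weighted-h-expand : ∀ b′ (w : ℕ → ℚ) N L → N ℕ.≤ L →
    ∑ℚ N (λ n → w (suc n) * ℕ→ℚ (h (suc b′) (suc n))) ≡
    ∑ℚ L (λ d → φ (suc d) * ∑ℚ N (λ n → 𝟙 (suc d ℕ.^ suc b′ ∣? suc n) *
                                 (w (suc n) * (ℕ→ℚ (suc n) * 1/ℕ (suc d ℕ.^ suc b′)))))
  weighted-h-expand b′ w N L N≤L = trans (∑ℚ-cong N row)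
    (trans (∑ℚ-swap N L λ n d → φ (suc d) * t n d) (∑ℚ-cong L λ d _ → ∑ℚ-*ˡ N (φ (suc d)) (λ n → t n d)))
    where
    b = suc b′
    t : ℕ → ℕ → ℚ
    t n d = 𝟙 (suc d ℕ.^ b ∣? suc n) * (w (suc n) * (ℕ→ℚ (suc n) * 1/ℕ (suc d ℕ.^ b)))
    row : ∀ n → n ℕ.< N → w (suc n) * ℕ→ℚ (h b (suc n)) ≡ ∑ℚ L (λ d → φ (suc d) * t n d)
    row n n<N = trans (cong (w (suc n) *_) (h-expand b′ (suc n) L (ℕₚ.≤-trans n<N N≤L)))
      (trans (sym (∑ℚ-*ˡ L (w (suc n)) _))
        (∑ℚ-cong L λ d _ → solve 4 (λ w p i x → w :* (p :* (i :* x)) := p :* (i :* (w :* x))) refl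
          (w (suc n)) (φ (suc d)) (𝟙 (suc d ℕ.^ b ∣? suc n)) (ℕ→ℚ (suc n) * 1/ℕ (suc d ℕ.^ b))))

  -- The weighted sum at a rational point.

  1/ℕ-^-square : ∀ n b → 1 ℕ.≤ n → 1/ℕ (n ℕ.^ (2 ℕ.* b)) ≡ 1/ℕ (n ℕ.^ b) * 1/ℕ (n ℕ.^ b)
  1/ℕ-^-square n b 1≤n = trans
    (cong 1/ℕ (trans (cong (λ t → n ℕ.^ (b ℕ.+ t)) (ℕₚ.+-identityʳ b)) (ℕₚ.^-distribˡ-+-* n b b)))
    (1/ℕ-* (ℕₚ.m^n>0 n {{ℕ.>-nonZero 1≤n}} b) (ℕₚ.m^n>0 n {{ℕ.>-nonZero 1≤n}} b))

  -- Here b ≥ 4 makes |φ(d)| d^-b at most d^-2, so the errors of all slices add up to a bounded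
  -- multiple of q.
  sq*1/ℕ^≤ : ∀ {n b} → 1 ℕ.≤ n → 4 ℕ.≤ b → sq n * 1/ℕ (n ℕ.^ b) ≤ 1/ℕ (n ℕ.^ 2)
  sq*1/ℕ^≤ {n} {b} 1≤n 4≤b = *1/ℕ≤ {n ℕ.* n} {n ℕ.^ 2} (ℕₚ.*-mono-≤ 1≤n 1≤n)
    (ℕₚ.m^n>0 n {{ℕ.>-nonZero 1≤n}} 2)
    (ℕₚ.≤-trans (ℕₚ.≤-reflexive (trans
        (cong (λ t → n ℕ.* t ℕ.* n ℕ.^ 2) (sym (ℕₚ.*-identityʳ n)))
        (sym (ℕₚ.^-distribˡ-+-* n 2 2))))
      (ℕₚ.^-monoʳ-≤ n {{ℕ.>-nonZero 1≤n}} 4≤b))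

  -- The length N and the point q are separate arguments: N is fixed by the real x, while q runs
  -- through its approximations.
  riesz : ℕ → ℕ → ℚ → ℚ
  riesz b N q = ∑ℚ N (λ n → (1ℚ - ℕ→ℚ (suc n) * recip q) * ℕ→ℚ (h b (suc n)))

  -- The main terms (q d^-b)² add up to Φ(2b) q², and the slice errors to at most 26 q ∑ d^-2 ≤ 52
  -- q.
  riesz≈Φ : ∀ b → 4 ℕ.≤ b → ∀ N k → N ℕ.≤ k → ∀ {q} → 1ℚ ≤ q → ℕ→ℚ N ≤ q + 1ℚ → q ≤ ℕ→ℚ N + 1ℚ →
    ∣ ℕ→ℚ 6 * riesz b N q - Φ (2 ℕ.* b) k * (q * q) ∣ ≤ ℕ→ℚ 52 * q
  riesz≈Φ b@(suc b′) 4≤b N k N≤k {q} 1≤q N≤ ≤N = ≤-trans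
    (≤-reflexive (cong ∣_∣ (cong₂ _-_ lhs rhs)))
    (≤-trans (∑ℚ-∣-∣ k {λ d → φ (suc d) * (ℕ→ℚ 6 * T d)} {λ d → φ (suc d) * (y d * y d)}
        {λ d → (ℕ→ℚ 26 * q) * 1/ℕ (suc d ℕ.^ 2)} term)
    (≤-trans (≤-reflexive (∑ℚ-*ˡ k (ℕ→ℚ 26 * q) λ d → 1/ℕ (suc d ℕ.^ 2)))
    (≤-trans (*-monoˡ {ℕ→ℚ 26 * q} 0≤26q (ζ-partial≤2 2 ℕₚ.≤-refl k))
      (≤-reflexive (solve 1 (λ q → (con (ℕ→ℚ 26) :* q) :* con (ℕ→ℚ 2) := con (ℕ→ℚ 52) :* q) refl q)))))
    where
    0≤26q : 0ℚ ≤ ℕ→ℚ 26 * q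
    0≤26q = 0≤* (0≤ℕ→ℚ 26) (≤-trans (<⇒≤ 0<1) 1≤q)
    w : ℕ → ℚ
    w n = 1ℚ - ℕ→ℚ n * recip q
    y T : ℕ → ℚ
    y d = q * 1/ℕ (suc d ℕ.^ b)
    T d = ∑ℚ N (λ n → 𝟙 (suc d ℕ.^ b ∣? suc n) * (w (suc n) * (ℕ→ℚ (suc n) * 1/ℕ (suc d ℕ.^ b))))
    lhs : ℕ→ℚ 6 * riesz b N q ≡ ∑ℚ k (λ d → φ (suc d) * (ℕ→ℚ 6 * T d))
    lhs = trans (cong (ℕ→ℚ 6 *_) (weighted-h-expand b′ w N k N≤k))
      (trans (sym (∑ℚ-*ˡ k (ℕ→ℚ 6) λ d → φ (suc d) * T d))
        (∑ℚ-cong k λ d _ → exchange (ℕ→ℚ 6) (φ (suc d)) (T d)))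
      where
      exchange : ∀ s p t → s * (p * t) ≡ p * (s * t)
      exchange = solve 3 (λ s p t → s :* (p :* t) := p :* (s :* t)) refl
    rhs : Φ (2 ℕ.* b) k * (q * q) ≡ ∑ℚ k (λ d → φ (suc d) * (y d * y d))
    rhs = trans (ℚₚ.*-comm (Φ (2 ℕ.* b) k) (q * q))
      (trans (sym (∑ℚ-*ˡ k (q * q) λ d → φ (suc d) * 1/ℕ (suc d ℕ.^ (2 ℕ.* b))))
        (∑ℚ-cong k λ d _ → trans
          (cong (λ t → (q * q) * (φ (suc d) * t)) (1/ℕ-^-square (suc d) b (ℕ.s≤s ℕ.z≤n)))
          (regroup (φ (suc d)) (1/ℕ (suc d ℕ.^ b)))))
      where
      regroup : ∀ p r → (q * q) * (p * (r * r)) ≡ p * ((q * r) * (q * r))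
      regroup = solve 3 (λ q p r → (q :* q) :* (p :* (r :* r)) := p :* ((q :* r) :* (q :* r))) refl q
    scaled : ∀ {p s c r i t} → ∣ p ∣ ≤ s → ∣ t - (q * r) * (q * r) ∣ ≤ c * (q * r) → 0ℚ ≤ c * q → s * r ≤ i →
             ∣ p * t - p * ((q * r) * (q * r)) ∣ ≤ (c * q) * i
    scaled {p} {s} {c} {r} {i} {t} p≤s e 0≤cq sr≤i = ≤-trans
      (≤-reflexive (cong ∣_∣ (solve 3 (λ p t x → p :* t :- p :* x := p :* (t :- x)) refl p t ((q * r) * (q * r)))))
      (≤-trans (∣*∣≤ {p} p≤s e)
      (≤-trans (≤-reflexive (solve 4 (λ s c q r → s :* (c :* (q :* r)) := (c :* q) :* (s :* r)) refl s c q r))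
        (*-monoˡ 0≤cq sr≤i)))
    term : ∀ d → d ℕ.< k → ∣ φ (suc d) * (ℕ→ℚ 6 * T d) - φ (suc d) * (y d * y d) ∣ ≤ (ℕ→ℚ 26 * q) * 1/ℕ (suc d ℕ.^ 2)
    term d _ = scaled {φ (suc d)} {sq (suc d)} {ℕ→ℚ 26} {1/ℕ (suc d ℕ.^ b)} {1/ℕ (suc d ℕ.^ 2)} {ℕ→ℚ 6 * T d}
      (∣φ∣≤sq (suc d)) (slice-error (suc d ℕ.^ b) (ℕₚ.m^n>0 (suc d) b) N {q} 1≤q N≤ ≤N) 0≤26q
      (sq*1/ℕ^≤ {suc d} {b} (ℕ.s≤s ℕ.z≤n) 4≤b)

  -- Every node is at most q, so each integrand value is at least 1 / q and the Riemann sum is at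
  -- least (q - 1) / q ≥ 1/2.
  1≤2*riemann : ∀ k {q} → ℕ→ℚ 2 ≤ q → 1ℚ ≤ ℕ→ℚ 2 * riemann k q
  1≤2*riemann k {q} 2≤q = ≤-trans 1≤ (*-monoˡ {ℕ→ℚ 2} (0≤ℕ→ℚ 2)
    (≤-trans (≤-reflexive total) (∑ℚ-mono T {λ _ → w * recip q} {λ i → w * recip (1ℚ + ℕ→ℚ (suc i) * w)} term)))
    where
    T = 2 ℕ.^ k
    w = (q - 1ℚ) * mesh k
    0<2 = 0<ℕ→ℚ {2} (ℕ.s≤s ℕ.z≤n)
    0<q = <-≤-trans 0<2 2≤q
    1≤q : 1ℚ ≤ q
    1≤q = ≤-trans (ℕ→ℚ-mono {1} {2} (ℕ.s≤s ℕ.z≤n)) 2≤q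
    0≤w : 0ℚ ≤ w
    0≤w = 0≤* (≤⇒0≤ 1≤q) (<⇒≤ (0<mesh k))
    node≤ : ∀ i → i ℕ.< T → 1ℚ + ℕ→ℚ (suc i) * w ≤ q
    node≤ i i<T = 0≤⇒≤ (subst (0ℚ ≤_)
      (solve 3 (λ q n r → (q :- con 1ℚ) :* (con 1ℚ :- n :* r) := q :- (con 1ℚ :+ n :* ((q :- con 1ℚ) :* r)))
        refl q (ℕ→ℚ (suc i)) (mesh k))
      (0≤* (≤⇒0≤ 1≤q) (≤⇒0≤ (subst (ℕ→ℚ (suc i) * mesh k ≤_) (mesh-inverse k)
        (*-monoʳ (<⇒≤ (0<mesh k)) (ℕ→ℚ-mono i<T))))))
    term : ∀ i → i ℕ.< T → w * recip q ≤ w * recip (1ℚ + ℕ→ℚ (suc i) * w)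
    term i i<T = *-monoˡ {w} 0≤w
      (recip-anti (0<+ 0<1 (0≤* (0≤ℕ→ℚ (suc i)) 0≤w)) (node≤ i i<T))
    total : 1ℚ - recip q ≡ ∑ℚ T (λ _ → w * recip q)
    total = sym (trans (∑ℚ-const T (w * recip q))
      (trans (solve 4 (λ t q m r → t :* (((q :- con 1ℚ) :* m) :* r) := (t :* m) :* (q :* r :- r)) refl
               (ℕ→ℚ T) q (mesh k) (recip q))
      (trans (cong₂ (λ s t → s * (t - recip q)) (mesh-inverse k) (recip-inverse 0<q))
        (ℚₚ.*-identityˡ _))))
    1≤ : 1ℚ ≤ ℕ→ℚ 2 * (1ℚ - recip q)
    1≤ = 0≤⇒≤ (subst (0ℚ ≤_)
      (trans (solve 3 (λ t h r → t :* (h :- r) := t :* (con 1ℚ :- r) :- (t :- t :* h)) refl (ℕ→ℚ 2) (1/ℕ 2) (recip q))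
        (cong (λ t → ℕ→ℚ 2 * (1ℚ - recip q) - (ℕ→ℚ 2 - t)) (recip-inverse 0<2)))
      (0≤* (0≤ℕ→ℚ 2) (≤⇒0≤ (recip-anti 0<2 2≤q))))

  ∣∣≤∣6*∣ : ∀ p → ∣ p ∣ ≤ ∣ ℕ→ℚ 6 * p ∣
  ∣∣≤∣6*∣ p = ≤-trans (≤-reflexive (sym (ℚₚ.*-identityˡ ∣ p ∣)))
    (≤-trans (*-monoʳ (0≤∣∣ p) (ℕ→ℚ-mono {1} {6} (ℕ.s≤s ℕ.z≤n)))
      (≤-reflexive (sym (ℚₚ.∣p*q∣≡∣p∣*∣q∣ (ℕ→ℚ 6) p))))

  combine : ∀ {S c f q A B D} → ∣ ℕ→ℚ 6 * S - f * (q * q) ∣ ≤ A → ∣ ℕ→ℚ 6 * c - f ∣ ≤ B → q * q ≤ D → 0ℚ ≤ q * q → 0ℚ ≤ B →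
    ∣ S - c * (q * q) ∣ ≤ A + B * D
  combine {S} {c} {f} {q} {A} {B} {D} p r qq≤D 0≤qq 0≤B = ≤-trans (∣∣≤∣6*∣ (S - c * (q * q)))
    (≤-trans (≤-reflexive (cong ∣_∣ (solve 5
        (λ n s c f x → n :* (s :- c :* x) := (n :* s :- f :* x) :+ :- ((n :* c :- f) :* x)) refl
        (ℕ→ℚ 6) S c f (q * q))))
      (∣+∣≤ {ℕ→ℚ 6 * S - f * (q * q)} p
        (≤-trans (≤-reflexive (ℚₚ.∣-p∣≡∣p∣ ((ℕ→ℚ 6 * c - f) * (q * q))))
          (∣*∣≤ {ℕ→ℚ 6 * c - f} r (0≤⇒∣∣≤ 0≤qq qq≤D)))))

  -- The truncation error (4 / k) q² is bounded with (N + 1)² in place of q², which does not move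
  -- with k and so lets the term be made smaller than any ε.
  riesz-asymptotic : ∀ b′ → 3 ℕ.≤ b′ → ∀ N k → N ℕ.≤ k → 1 ℕ.≤ k →
    ∀ {q} → ℕ→ℚ 2 ≤ q → ℕ→ℚ N ≤ q + 1ℚ → q ≤ ℕ→ℚ (suc N) → let b = suc b′ in
    ∣ riesz b N q - (ζ-partial (2 ℕ.* b ℕ.∸ 1) k * recip (ℕ→ℚ 6 * ζ-partial (2 ℕ.* b) k)) * (q * q) ∣
      ≤ ℕ→ℚ 104 * (q * riemann k q) + (ℕ→ℚ 4 * 1/ℕ k) * (ℕ→ℚ (suc N) * ℕ→ℚ (suc N))
  riesz-asymptotic b′ 3≤b′ N k N≤k 1≤k {q} 2≤q N≤ ≤N = ≤-trans
    (combine {riesz b N q} {ζ-partial t k * recip (ℕ→ℚ 6 * ζ-partial (suc t) k)} {Φ (suc t) k} {q}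
      (riesz≈Φ b (ℕ.s≤s 3≤b′) N k N≤k {q} 1≤q N≤ (≤-trans ≤N (≤-reflexive (trans (ℕ→ℚ-+ 1 N) (ℚₚ.+-comm 1ℚ (ℕ→ℚ N))))))
      (constant≈Φ t 4≤t k 1≤k)
      (*-mono-≤ 0≤q 0≤q ≤N ≤N) (0≤* 0≤q 0≤q) (0≤* (0≤ℕ→ℚ 4) (<⇒≤ (0<1/ℕ 1≤k))))
    (ℚₚ.+-monoˡ-≤ _ log-absorbs)
    where
    b = suc b′
    t = 2 ℕ.* b ℕ.∸ 1
    4≤t : 4 ℕ.≤ t
    -- By computation t is b′ + (b + 0), so `suc t` is 2b definitionally and the estimates for
    -- exponents t and t + 1 apply directly.
    4≤t = ℕₚ.≤-trans (ℕ.s≤s 3≤b′) (ℕₚ.≤-trans (ℕₚ.≤-reflexive (sym (ℕₚ.+-identityʳ (suc b′)))) (ℕₚ.m≤n+m (suc b′ ℕ.+ 0) b′))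
    1≤q : 1ℚ ≤ q
    1≤q = ≤-trans (ℕ→ℚ-mono {1} {2} (ℕ.s≤s ℕ.z≤n)) 2≤q
    0≤q = ≤-trans (<⇒≤ 0<1) 1≤q
    log-absorbs : ℕ→ℚ 52 * q ≤ ℕ→ℚ 104 * (q * riemann k q)
    log-absorbs = ≤-trans (≤-reflexive (sym (ℚₚ.*-identityʳ (ℕ→ℚ 52 * q))))
      (≤-trans (*-monoˡ {ℕ→ℚ 52 * q} (0≤* (0≤ℕ→ℚ 52) 0≤q) (1≤2*riemann k 2≤q))
        (≤-reflexive (regroup q (riemann k q))))
      where
      regroup : ∀ q r → (ℕ→ℚ 52 * q) * (ℕ→ℚ 2 * r) ≡ ℕ→ℚ 104 * (q * r)
      regroup = solve 2 (λ q r → (con (ℕ→ℚ 52) :* q) :* (con (ℕ→ℚ 2) :* r) := con (ℕ→ℚ 104) :* (q :* r)) refl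

  eventually-small : ∀ D ε → 0ℚ < ε → 0ℚ < D → ∃[ K ] (1 ℕ.≤ K × (∀ k → K ℕ.≤ k → (ℕ→ℚ 4 * 1/ℕ k) * D ≤ ε))
  eventually-small D ε 0<ε 0<D =
    let K , 1≤K , K⁻¹≤ = archimedean (recip (ℕ→ℚ 4 * D) * ε) (RationalLemmas.0<* (0<recip 0<4D) 0<ε)
    in K , 1≤K , λ k K≤k → ≤-trans
      (≤-reflexive (solve 3 (λ c r d → (c :* r) :* d := (c :* d) :* r) refl (ℕ→ℚ 4) (1/ℕ k) D))
      (≤-trans (*-monoˡ {ℕ→ℚ 4 * D} (<⇒≤ 0<4D) (≤-trans (recip-anti (0<ℕ→ℚ 1≤K) (ℕ→ℚ-mono K≤k)) K⁻¹≤))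
        (≤-reflexive (trans (sym (ℚₚ.*-assoc (ℕ→ℚ 4 * D) (recip (ℕ→ℚ 4 * D)) ε))
          (trans (cong (_* ε) (recip-inverse 0<4D)) (ℚₚ.*-identityˡ ε)))))
    where
    0<4D : 0ℚ < ℕ→ℚ 4 * D
    0<4D = RationalLemmas.0<* (0<ℕ→ℚ {4} (ℕ.s≤s ℕ.z≤n)) 0<D

  cancel-1 : ∀ {q} → ℕ→ℚ 3 ≤ q + 1ℚ → ℕ→ℚ 2 ≤ q
  cancel-1 {q} le = 0≤⇒≤ (subst (0ℚ ≤_)
    (solve 1 (λ q → (q :+ con 1ℚ) :- con (ℕ→ℚ 3) := q :- con (ℕ→ℚ 2)) refl q) (≤⇒0≤ le))

  drop-gap : ∀ {q δ r} → 0ℚ < δ → q + δ ≤ r → q ≤ r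
  drop-gap {q} {δ} 0<δ le = ≤-trans (≤-reflexive (sym (ℚₚ.+-identityʳ q)))
    (≤-trans (ℚₚ.+-monoʳ-≤ q (<⇒≤ 0<δ)) le)

-- Passage to the real numbers.

seq-∑ : ∀ N f k → seq (∑[1⋯ N ] f) k ≡ ∑ℚ N (λ n → seq (f (suc n)) k)
seq-∑ zero    f k = refl
seq-∑ (suc N) f k = cong (Rat._+ seq (f (suc N)) k) (seq-∑ N f k)

open Defs using (_≤_; _<_; _+_; _*_; _-_; ∣_∣)

theorem1p2 :
    (b : ℕ) (b>3 : 3 ℕ.< b) →
    ∃[ C ] ∃[ x₀ ]
      ((x : ℝ) (x>0 : fromℕ 0 < x) → x₀ ≤ x →
       (N : ℕ) → fromℕ N ≤ x → x < fromℕ (suc N) →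
       ∣ ∑[1⋯ N ] (λ n → (fromℕ 1 - fromℕ n ÷ x ⟨ x>0 ⟩) * fromℕ (h b n))
         - (ζ (2 ℕ.* b ℕ.∸ 1) (1<2b-1 b>3)
             ÷ (fromℕ 6 * ζ (2 ℕ.* b) (1<2b b>3)) ⟨ 0<6ζ (2 ℕ.* b) (1<2b b>3) ⟩)
           * (x * x) ∣
       ≤ C * (x * log x x>0))
-- The threshold is 3 because 3 ≤ x, read with slack 1, yields q ≥ 2, which is what the lower bound
-- for the logarithm requires.
theorem1p2 (suc b′) b>3@(ℕ.s≤s 3≤b′) = fromℕ 104 , fromℕ 3 , λ x x>0 3≤x N N≤x x<N+1 ε 0<ε →
  let b = suc b′
      D = ℕ→ℚ (suc N) Rat.* ℕ→ℚ (suc N)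
      0<N+1 = RationalLemmas.0<ℕ→ℚ {suc N} (ℕ.s≤s ℕ.z≤n)
      K₁ , p₁ = 3≤x 1ℚ RationalLemmas.0<1
      K₂ , p₂ = N≤x 1ℚ RationalLemmas.0<1
      δ , 0<δ , K₃ , p₃ = x<N+1
      K₄ , 1≤K₄ , p₄ = Rationals.eventually-small D ε 0<ε (RationalLemmas.0<* 0<N+1 0<N+1)
      -- N joins the maximum so that the sum over d cut at k still contains every divisor that
      -- occurs in `h b n` for n ≤ N.
      K = (K₁ ℕ.⊔ K₂) ℕ.⊔ (K₃ ℕ.⊔ (K₄ ℕ.⊔ N))
  in K , λ k K≤k →
    let q = seq x k
        l = ℕₚ.≤-trans (ℕₚ.m≤m⊔n (K₁ ℕ.⊔ K₂) (K₃ ℕ.⊔ (K₄ ℕ.⊔ N))) K≤k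
        r = ℕₚ.≤-trans (ℕₚ.m≤n⊔m (K₁ ℕ.⊔ K₂) (K₃ ℕ.⊔ (K₄ ℕ.⊔ N))) K≤k
        r′ = ℕₚ.≤-trans (ℕₚ.m≤n⊔m K₃ (K₄ ℕ.⊔ N)) r
        k₁ = ℕₚ.≤-trans (ℕₚ.m≤m⊔n K₁ K₂) l
        k₂ = ℕₚ.≤-trans (ℕₚ.m≤n⊔m K₁ K₂) l
        k₃ = ℕₚ.≤-trans (ℕₚ.m≤m⊔n K₃ (K₄ ℕ.⊔ N)) r
        k₄ = ℕₚ.≤-trans (ℕₚ.m≤m⊔n K₄ N) r′
        N≤k = ℕₚ.≤-trans (ℕₚ.m≤n⊔m K₄ N) r′
        c = ζ-partial (2 ℕ.* b ℕ.∸ 1) k Rat.* recip (ℕ→ℚ 6 Rat.* ζ-partial (2 ℕ.* b) k)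
    in ℚₚ.≤-trans
      (ℚₚ.≤-reflexive (cong (λ s → Rat.∣ s Rat.- c Rat.* (q Rat.* q) ∣)
        (seq-∑ N (λ n → (fromℕ 1 - fromℕ n ÷ x ⟨ x>0 ⟩) * fromℕ (h b n)) k)))
      (ℚₚ.≤-trans
        (Rationals.riesz-asymptotic b′ 3≤b′ N k N≤k (ℕₚ.≤-trans 1≤K₄ k₄) {q}
          (Rationals.cancel-1 (p₁ k k₁)) (p₂ k k₂) (Rationals.drop-gap 0<δ (p₃ k k₃)))
        (ℚₚ.+-monoʳ-≤ (ℕ→ℚ 104 Rat.* (q Rat.* riemann k q)) (p₄ k k₄)))
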